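{- Let $w$ be an infinite word over a finite totally ordered alphabet $A\supseteq\{0,1\}$ with $0<1$, such that both letters $0$ and $1$ occur in $w$. Then $w$ is Sturmian if and only if for every pair $v,v'$ of lexicographically consecutive factors of $w$ of the same length, there exist words $\lambda,\mu\in A^*$ such that $v,v'$ either both belong to $\{\lambda 01\mu,\ \lambda 10\mu\}$ or both belong to $\{\lambda 0,\ \lambda 1\}$.
   Context: $A^*$ is the set of finite words over $A$ (including the empty word). An infinite word over $A$ is a sequence in $A^\omega$ (indexed by $\mathbb{N}$). A factor of $w$ is a finite word occurring as a block of consecutive letters of $w$; $\mathrm{Fact}(w)$ is the set of factors of $w$. For finite words, $v<_{\mathrm{lex}}v'$ means $|v|=|v'|$ and there are a word $\lambda$ and letters $a<b$ such that $\lambda a$ is a prefix of $v$ and $\lambda b$ is a prefix of $v'$. Two factors $v,v'$ of $w$ are lexicographically consecutive (with $v'$ the successor of $v$, written $v'=\mathrm{succ}_w(v)$) if $v<_{\mathrm{lex}}v'$ and there is no $f\in\mathrm{Fact}(w)$ with $v<_{\mathrm{lex}}f<_{\mathrm{lex}}v'$. An infinite word $w$ is Sturmian if for every $n\ge 0$ it has exactly $n+1$ distinct factors of length $n$ (equivalently, $w$ is a binary word that is not ultimately periodic and is balanced, i.e. for any two factors $u,u'$ of equal length and each letter $x$, the numbers of occurrences of $x$ in $u$ and in $u'$ differ by at most $1$). -}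

module Defs where

open import Data.List using (List; []; _∷_; _++_; _∷ʳ_; length; applyUpTo)
open import Data.List.Membership.Propositional using (_∈_)
open import Data.List.Relation.Binary.Prefix.Heterogeneous using (Prefix)
open import Data.List.Relation.Unary.Unique.Propositional using (Unique)
open import Data.Nat using (ℕ; suc; _+_)
open import Data.Product using (∃-syntax; _×_)
open import Data.Sum using (_⊎_)
open import Function.Bundles using (_⇔_)
open import Level using (0ℓ)
open import Relation.Binary.Core using (Rel)
open import Relation.Binary.PropositionalEquality using (_≡_)
open import Relation.Nullary using (¬_)

Word : Set → Set
Word = List

InfiniteWord : Set → Set
InfiniteWord A = ℕ → A

module _ {A : Set} where

  Occurs : A → InfiniteWord A → Set
  Occurs a w = ∃[ i ] w i ≡ a

  Factor : InfiniteWord A → Word A → Set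
  Factor w u = ∃[ i ] u ≡ applyUpTo (λ j → w (i + j)) (length u)

  -- The n + 1 factors of length n are given by a repetition-free list of
  -- length n + 1 whose members are precisely those factors.
  Sturmian : InfiniteWord A → Set
  Sturmian w = ∀ n → ∃[ us ]
    (length us ≡ suc n × Unique us ×
     (∀ u → u ∈ us ⇔ (Factor w u × length u ≡ n)))

  Lex : Rel A 0ℓ → Rel (Word A) 0ℓ
  Lex _<_ v v′ = length v ≡ length v′ ×
    ∃[ l ] ∃[ a ] ∃[ b ]
      (a < b × Prefix _≡_ (l ∷ʳ a) v × Prefix _≡_ (l ∷ʳ b) v′)

  -- v′ is the successor of v; Lex already forces v and v′ to have the
  -- same length.
  Consecutive : Rel A 0ℓ → InfiniteWord A → Rel (Word A) 0ℓ
  Consecutive _<_ w v v′ =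
    Factor w v × Factor w v′ × Lex _<_ v v′ ×
    ¬ (∃[ f ] (Factor w f × Lex _<_ v f × Lex _<_ f v′))

  BothIn : List (Word A) → Rel (Word A) 0ℓ
  BothIn us v v′ = v ∈ us × v′ ∈ us

  SwapOrLastLetter : A → A → Rel (Word A) 0ℓ
  SwapOrLastLetter 𝟎 𝟏 v v′ = ∃[ l ] ∃[ m ]
    ( BothIn ((l ++ 𝟎 ∷ 𝟏 ∷ m) ∷ (l ++ 𝟏 ∷ 𝟎 ∷ m) ∷ []) v v′
    ⊎ BothIn ((l ∷ʳ 𝟎) ∷ (l ∷ʳ 𝟏) ∷ []) v v′)

{-# OPTIONS --safe #-}
module Submission where

-- Write O and I for the letters 0 and 1, the only ones that occur under either
-- hypothesis.  For a binary word, the condition on consecutive factors says that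
-- for every right special l and every m there is u of length m such that l01u is
-- the greatest factor with prefix l0 and l10u the least one with prefix l1;
-- extremality makes u independent of l.
--
-- Given this, the number of ones is nondecreasing along the lexicographic order,
-- and 0p and 1p cannot both be right special: up to complementation some 1p1 is
-- preceded by a 0, so monotonicity confines 0p0 to the initial run of zeros and
-- w = 0ⁱ⁺¹p01U; since 10U is the least word beginning with 1, the factors 10p10U
-- and 10U give U = p10U, and this period excludes 1p01U.  So there is exactly one
-- right special factor of each length.
--
-- Conversely, suppose that there is one right special factor of each length.
-- The word is balanced: take a shortest pair 0p0, 1p1 with, say, 0p right special.
-- No 0p starts within an occurrence of 1p1, so afterwards some factor repeats
-- without 0p in between, and 0p never occurs again.  By balance the number of
-- ones jumps at most once among the sorted factors of length n, and it does so at
-- r0 < r1 for r right special of length n - 1.  Hence it is constant at every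
-- consecutive pair l0x < l1y with x nonempty, and likewise for the prefixes of
-- the pair, which forces x = 1u and y = 0u.

open import Defs
open import Axiom.ExcludedMiddle using (ExcludedMiddle)
open import Data.Bool using (Bool; not) renaming (false to O; true to I)
open import Data.Bool.Properties using (not-injective; not-involutive)
open import Data.Empty using (⊥; ⊥-elim)
open import Data.Fin using (Fin; zero; suc; toℕ) renaming (_<_ to _<ᶠ_)
import Data.Fin.Properties as Fin
open import Data.List using
  (List; []; _∷_; _++_; _∷ʳ_; length; map; applyUpTo; lookup; allFin; initLast; _∷ʳ′_)
open import Data.List.Membership.Propositional using (_∈_)
open import Data.List.Membership.Propositional.Properties using (∈-map⁺; ∈-map⁻; ∈-lookup; ∈-allFin)
import Data.List.Membership.Setoid.Properties as Membership
open import Data.List.Properties using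
  (length-++; length-map; map-++; map-injective; ++-assoc; ++-cancelˡ; ∷ʳ-++;
   ∷-injective; ∷-injectiveˡ; ∷-injectiveʳ; ∷ʳ-injectiveˡ; ∷ʳ-injectiveʳ)
open import Data.List.Relation.Binary.Prefix.Heterogeneous using (Prefix; []; _∷_)
open import Data.List.Relation.Unary.All as All using (All; []; _∷_)
open import Data.List.Relation.Unary.AllPairs using ([]; _∷_)
open import Data.List.Relation.Unary.Any using (here; there; index)
open import Data.List.Relation.Unary.Unique.Propositional using (Unique)
import Data.List.Relation.Unary.Unique.Propositional.Properties as Unique
open import Data.Nat as ℕ using (ℕ; zero; suc; _+_; _≤_; _<_; z≤n; s≤s)
open import Data.Nat.Properties
open import Data.Product using (∃-syntax; _×_; _,_; proj₁; proj₂)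
open import Data.Sum using (_⊎_; inj₁; inj₂)
open import Data.Unit using (⊤; tt)
open import Function using (_∘_)
open import Function.Bundles using (_⇔_; _↔_; mk⇔; Equivalence; Inverse)
open import Level using (0ℓ)
open import Relation.Binary.Core using (Rel)
open import Relation.Binary.Definitions using (tri<; tri≈; tri>)
open import Relation.Binary.PropositionalEquality
open import Relation.Binary.Structures using (IsStrictTotalOrder)
open import Relation.Nullary using (¬_; yes; no; contradiction)

-- Words, factors and the lexicographic order

module _ {A : Set} where

  -- Recursion on the word lets pattern matching read off letters, which the `applyUpTo` form of
  -- `Factor` does not; the two forms are converted into each other below.
  At : InfiniteWord A → ℕ → Word A → Set
  At w i []      = ⊤
  At w i (a ∷ u) = w i ≡ a × At w (suc i) u

  Occurring : InfiniteWord A → Word A → Set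
  Occurring w u = ∃[ i ] At w i u

  at-++ˡ : ∀ {w i} u {v} → At w i (u ++ v) → At w i u
  at-++ˡ []      _       = tt
  at-++ˡ (a ∷ u) (e , p) = e , at-++ˡ u p

  at-++ʳ : ∀ {w i} u {v} → At w i (u ++ v) → At w (i + length u) v
  at-++ʳ {w} {i} []      {v} p       = subst (λ j → At w j v) (sym (+-identityʳ i)) p
  at-++ʳ {w} {i} (a ∷ u) {v} (e , p) =
    subst (λ j → At w j v) (sym (+-suc i (length u))) (at-++ʳ u p)

  at-++ : ∀ {w i} u {v} → At w i u → At w (i + length u) v → At w i (u ++ v)
  at-++ {w} {i} []      {v} _       q = subst (λ j → At w j v) (+-identityʳ i) q
  at-++ {w} {i} (a ∷ u) {v} (e , p) q =
    e , at-++ u p (subst (λ j → At w j v) (+-suc i (length u)) q)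

  occurring-++ˡ : ∀ {w} u {v} → Occurring w (u ++ v) → Occurring w u
  occurring-++ˡ u (i , p) = i , at-++ˡ u p

  occurring-++ʳ : ∀ {w} u {v} → Occurring w (u ++ v) → Occurring w v
  occurring-++ʳ u (i , p) = i + length u , at-++ʳ u p

  window : InfiniteWord A → ℕ → ℕ → Word A
  window w i zero    = []
  window w i (suc n) = w i ∷ window w (suc i) n

  window-at : ∀ w i n → At w i (window w i n)
  window-at w i zero    = tt
  window-at w i (suc n) = refl , window-at w (suc i) n

  length-window : ∀ w i n → length (window w i n) ≡ n
  length-window w i zero    = refl
  length-window w i (suc n) = cong suc (length-window w (suc i) n)

  at-prefix : ∀ {w i} u v → At w i u → At w i v → length u ≤ length v →
              ∃[ v′ ] v ≡ u ++ v′
  at-prefix []      v       _          _          _         = v , refl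
  at-prefix (a ∷ u) (b ∷ v) (refl , p) (refl , q) (s≤s u≤v)
    with v′ , refl ← at-prefix u v p q u≤v = v′ , refl

  at-unique : ∀ {w i} u v → At w i u → At w i v → length u ≡ length v → u ≡ v
  at-unique []      []      _          _          _ = refl
  at-unique (a ∷ u) (b ∷ v) (refl , p) (refl , q) e =
    cong (a ∷_) (at-unique u v p q (suc-injective e))

  occurring-extend : ∀ {w} u → Occurring w u → ∀ n →
                     ∃[ v ] (length v ≡ n × Occurring w (u ++ v))
  occurring-extend {w} u (i , p) n =
    window w (i + length u) n , length-window w _ n ,
    i , at-++ u p (window-at w (i + length u) n)

  at⇒window : ∀ {w i} u → At w i u → u ≡ applyUpTo (λ j → w (i + j)) (length u)
  at⇒window u p = go u (λ j → refl) p
    where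
    -- `applyUpTo` shifts its function where `At` shifts the position, hence the generalisation to
    -- any `f` that agrees with `w` from `i` on.
    go : ∀ {w i f} u → (∀ j → w (i + j) ≡ f j) → At w i u → u ≡ applyUpTo f (length u)
    go []              h _          = refl
    go {w} {i} (a ∷ u) h (refl , p) =
      cong₂ _∷_ (trans (cong w (sym (+-identityʳ i))) (h 0))
        (go u (λ j → trans (cong w (sym (+-suc i j))) (h (suc j))) p)

  window⇒at : ∀ {w i} u → u ≡ applyUpTo (λ j → w (i + j)) (length u) → At w i u
  window⇒at u p = go u (λ j → refl) p
    where
    go : ∀ {w i f} u → (∀ j → w (i + j) ≡ f j) → u ≡ applyUpTo f (length u) → At w i u
    go []              h _ = tt
    go {w} {i} (a ∷ u) h e with refl , e′ ← ∷-injective e =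
      trans (cong w (sym (+-identityʳ i))) (h 0) ,
      go u (λ j → trans (cong w (sym (+-suc i j))) (h (suc j))) e′

  factor⇒occurring : ∀ {w} u → Factor w u → Occurring w u
  factor⇒occurring u (i , p) = i , window⇒at u p

  occurring⇒factor : ∀ {w} u → Occurring w u → Factor w u
  occurring⇒factor u (i , p) = i , at⇒window u p

module _ {A B : Set} {g : A → B} {w : InfiniteWord A} where

  at-map⁺ : ∀ {i} u → At w i u → At (g ∘ w) i (map g u)
  at-map⁺ []      _       = tt
  at-map⁺ (a ∷ u) (e , p) = cong g e , at-map⁺ u p

  at-map⁻ : (∀ {x y} → g x ≡ g y → x ≡ y) → ∀ {i} u → At (g ∘ w) i (map g u) → At w i u
  at-map⁻ inj []      _       = tt
  at-map⁻ inj (a ∷ u) (e , p) = inj e , at-map⁻ inj u p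

  occurring-map⁺ : ∀ u → Occurring w u → Occurring (g ∘ w) (map g u)
  occurring-map⁺ u (i , p) = i , at-map⁺ u p

  occurring-map⁻ : (∀ {x y} → g x ≡ g y → x ≡ y) → ∀ u → Occurring (g ∘ w) (map g u) → Occurring w u
  occurring-map⁻ inj u (i , p) = i , at-map⁻ inj u p

  at-map-image : ∀ {i} v → At (g ∘ w) i v → ∃[ u ] v ≡ map g u
  at-map-image []      _ = [] , refl
  at-map-image {i} (b ∷ v) (refl , p) with u , refl ← at-map-image v p = w i ∷ u , refl

length-++-∷ : ∀ {A : Set} (u : Word A) {a v} → length (u ++ a ∷ v) ≡ suc (length (u ++ v))
length-++-∷ []      = refl
length-++-∷ (b ∷ u) = cong suc (length-++-∷ u)

split-at : ∀ {A : Set} k {n} (u : Word A) → length u ≡ k + n →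
           ∃[ u₁ ] ∃[ u₂ ] (u ≡ u₁ ++ u₂ × length u₁ ≡ k × length u₂ ≡ n)
split-at zero    u       e = [] , u , refl , refl , e
split-at (suc k) (a ∷ u) e
  with u₁ , u₂ , refl , e₁ , e₂ ← split-at k u (suc-injective e) =
  a ∷ u₁ , u₂ , refl , cong suc e₁ , e₂

-- Numbers of ones and the lexicographic order on binary words

ones : Word Bool → ℕ
ones []      = 0
ones (O ∷ u) = ones u
ones (I ∷ u) = suc (ones u)

ones-++ : ∀ u v → ones (u ++ v) ≡ ones u + ones v
ones-++ []      v = refl
ones-++ (O ∷ u) v = ones-++ u v
ones-++ (I ∷ u) v = cong suc (ones-++ u v)

infix 4 _≼_

data _≼_ : Word Bool → Word Bool → Set where
  []  : [] ≼ []
  _∷_ : ∀ a {u v} → u ≼ v → a ∷ u ≼ a ∷ v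
  O≺I : ∀ {u v} → length u ≡ length v → O ∷ u ≼ I ∷ v

≼-refl : ∀ u → u ≼ u
≼-refl []      = []
≼-refl (a ∷ u) = a ∷ ≼-refl u

≼-length : ∀ {u v} → u ≼ v → length u ≡ length v
≼-length []      = refl
≼-length (a ∷ p) = cong suc (≼-length p)
≼-length (O≺I e) = cong suc e

≼-antisym : ∀ {u v} → u ≼ v → v ≼ u → u ≡ v
≼-antisym []      _       = refl
≼-antisym (a ∷ p) (_ ∷ q) = cong (a ∷_) (≼-antisym p q)

≼-total : ∀ u v → length u ≡ length v → u ≼ v ⊎ v ≼ u
≼-total []      []      _ = inj₁ []
≼-total (O ∷ u) (I ∷ v) e = inj₁ (O≺I (suc-injective e))
≼-total (I ∷ u) (O ∷ v) e = inj₂ (O≺I (sym (suc-injective e)))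
≼-total (O ∷ u) (O ∷ v) e with ≼-total u v (suc-injective e)
... | inj₁ p = inj₁ (O ∷ p)
... | inj₂ p = inj₂ (O ∷ p)
≼-total (I ∷ u) (I ∷ v) e with ≼-total u v (suc-injective e)
... | inj₁ p = inj₁ (I ∷ p)
... | inj₂ p = inj₂ (I ∷ p)

≼-++ : ∀ {u v u′ v′} → u ≼ v → length u′ ≡ length v′ → (u ≡ v → u′ ≼ v′) →
       u ++ u′ ≼ v ++ v′
≼-++ []      e h = h refl
≼-++ (a ∷ p) e h = a ∷ ≼-++ p e (λ q → h (cong (a ∷_) q))
≼-++ {O ∷ u} {I ∷ v} {u′} {v′} (O≺I d) e h =
  O≺I (trans (length-++ u) (trans (cong₂ _+_ d e) (sym (length-++ v))))

≼-++⁻ˡ : ∀ u v {u′ v′} → length u ≡ length v → u ++ u′ ≼ v ++ v′ → u ≼ v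
≼-++⁻ˡ []      []      e p       = []
≼-++⁻ˡ (a ∷ u) (b ∷ v) e (_ ∷ p) = a ∷ ≼-++⁻ˡ u v (suc-injective e) p
≼-++⁻ˡ (O ∷ u) (I ∷ v) e (O≺I _) = O≺I (suc-injective e)

≼-++⁻ʳ : ∀ u {v v′} → u ++ v ≼ u ++ v′ → v ≼ v′
≼-++⁻ʳ []      p       = p
≼-++⁻ʳ (a ∷ u) (_ ∷ p) = ≼-++⁻ʳ u p

-- Among all binary words of its length, u1 is the immediate successor of u0.
≼-∷ʳO : ∀ u {v} → u ++ O ∷ [] ≼ v → v ≡ u ++ O ∷ [] ⊎ u ++ I ∷ [] ≼ v
≼-∷ʳO []      (O ∷ [])       = inj₁ refl
≼-∷ʳO []      {I ∷ []} (O≺I e) = inj₂ (I ∷ [])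
≼-∷ʳO (a ∷ u) (a ∷ p) with ≼-∷ʳO u p
... | inj₁ e = inj₁ (cong (a ∷_) e)
... | inj₂ q = inj₂ (a ∷ q)
≼-∷ʳO (O ∷ u) (O≺I e) = inj₂ (O≺I (trans (trans (length-++-∷ u) (sym (length-++-∷ u))) e))

≼-map-not : ∀ u v → u ≼ map not v → v ≼ map not u
≼-map-not []      []      []      = []
≼-map-not (O ∷ u) (I ∷ v) (O ∷ p) = I ∷ ≼-map-not u v p
≼-map-not (I ∷ u) (O ∷ v) (I ∷ p) = O ∷ ≼-map-not u v p
≼-map-not (O ∷ u) (O ∷ v) (O≺I e) =
  O≺I (sym (trans (length-map not u) (trans e (length-map not v))))

map-not-≼ : ∀ u v → map not u ≼ v → map not v ≼ u
map-not-≼ []      []      []      = []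
map-not-≼ (I ∷ u) (O ∷ v) (O ∷ p) = I ∷ map-not-≼ u v p
map-not-≼ (O ∷ u) (I ∷ v) (I ∷ p) = O ∷ map-not-≼ u v p
map-not-≼ (I ∷ u) (I ∷ v) (O≺I e) =
  O≺I (trans (length-map not v) (trans (sym e) (length-map not u)))

-- Exchange of the two letters, right special factors and central pairs

map-not-involutive : ∀ u → map not (map not u) ≡ u
map-not-involutive []      = refl
map-not-involutive (a ∷ u) = cong₂ _∷_ (not-involutive a) (map-not-involutive u)

complement : InfiniteWord Bool → InfiniteWord Bool
complement b = not ∘ b

complement-occurring : ∀ {b} u → Occurring b (map not u) → Occurring (complement b) u
complement-occurring u p =
  subst (Occurring _) (map-not-involutive u) (occurring-map⁺ (map not u) p)

occurring-complement : ∀ {b} u → Occurring (complement b) u → Occurring b (map not u)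
occurring-complement {b} u p =
  occurring-map⁻ not-injective (map not u) (subst (Occurring _) (sym (map-not-involutive u)) p)

RightSpecial : InfiniteWord Bool → Word Bool → Set
RightSpecial b l = Occurring b (l ++ O ∷ []) × Occurring b (l ++ I ∷ [])

rightSpecial-complement : ∀ {b} l → RightSpecial (complement b) l → RightSpecial b (map not l)
rightSpecial-complement {b} l (p , q) =
  subst (Occurring b) (map-++ not l _) (occurring-complement (l ++ I ∷ []) q) ,
  subst (Occurring b) (map-++ not l _) (occurring-complement (l ++ O ∷ []) p)

rightSpecial-tail : ∀ {b a} l → RightSpecial b (a ∷ l) → RightSpecial b l
rightSpecial-tail {a = a} l (p , q) = occurring-++ʳ (a ∷ []) p , occurring-++ʳ (a ∷ []) q

-- The factors with prefix l0 and those with prefix l1 meet at l01u < l10u.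
record Central (b : InfiniteWord Bool) (l : Word Bool) (u : Word Bool) : Set where
  field
    lower   : Occurring b (l ++ O ∷ I ∷ u)
    upper   : Occurring b (l ++ I ∷ O ∷ u)
    maximal : ∀ x → length x ≡ suc (length u) → Occurring b (l ++ O ∷ x) → x ≼ I ∷ u
    minimal : ∀ y → length y ≡ suc (length u) → Occurring b (l ++ I ∷ y) → O ∷ u ≼ y

-- The condition on consecutive factors, read on binary words; `swap⇒hasCentral` and
-- `hasCentral⇒swap` prove the two forms equivalent. Here `m` is the length left after the two
-- exchanged letters.
HasCentral : InfiniteWord Bool → Set
HasCentral b = ∀ l → RightSpecial b l → ∀ m → ∃[ u ] (length u ≡ m × Central b l u)

-- Complementing letters turns l01u into a word of the form l10u and reverses the order, so `lower`
-- and `upper`, `maximal` and `minimal` trade places.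
hasCentral-complement : ∀ {b} → HasCentral b → HasCentral (complement b)
hasCentral-complement {b} K l r m
  with u , refl , c ← K (map not l) (rightSpecial-complement l r) m =
  map not u , length-map not u , record
    { lower   = complement-occurring (l ++ _) (subst (Occurring b)
        (e (I ∷ O ∷ u) (O ∷ I ∷ _) (cong (λ v → I ∷ O ∷ v) (sym (map-not-involutive u)))) upper)
    ; upper   = complement-occurring (l ++ _) (subst (Occurring b)
        (e (O ∷ I ∷ u) (I ∷ O ∷ _) (cong (λ v → O ∷ I ∷ v) (sym (map-not-involutive u)))) lower)
    ; maximal = λ x n p → ≼-map-not (O ∷ u) x (minimal (map not x) (len x n)
        (subst (Occurring b) (map-++ not l (O ∷ x)) (occurring-complement (l ++ O ∷ x) p)))
    ; minimal = λ y n p → map-not-≼ y (I ∷ u) (maximal (map not y) (len y n)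
        (subst (Occurring b) (map-++ not l (I ∷ y)) (occurring-complement (l ++ I ∷ y) p)))
    }
  where
  open Central c
  e : ∀ v v′ → v ≡ map not v′ → map not l ++ v ≡ map not (l ++ v′)
  e _ v′ refl = sym (map-++ not l v′)
  len : ∀ x → length x ≡ suc (length (map not u)) → length (map not x) ≡ suc (length u)
  len x n = trans (length-map not x) (trans n (cong suc (length-map not u)))

-- Words with central pairs

O≢I : ∀ {a : Bool} → a ≡ O → a ≡ I → ⊥
O≢I refl ()

ones-∷ʳO : ∀ u → ones (u ++ O ∷ []) ≡ ones u
ones-∷ʳO u = trans (ones-++ u _) (+-identityʳ _)

ones-∷ʳI : ∀ u → ones (u ++ I ∷ []) ≡ suc (ones u)
ones-∷ʳI u = trans (ones-++ u _) (+-comm _ 1)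

length-∷ʳ : ∀ {A : Set} (u : Word A) {a} → length (u ++ a ∷ []) ≡ suc (length u)
length-∷ʳ u = trans (length-++ u) (+-comm _ 1)

occurring-∷ʳ-++ : ∀ {A : Set} {w : InfiniteWord A} l {a x} →
                  Occurring w (l ++ a ∷ x) → Occurring w ((l ∷ʳ a) ++ x)
occurring-∷ʳ-++ {w = w} l {a} {x} = subst (Occurring w) (sym (∷ʳ-++ l a x))

rightSpecial-branch : ∀ {b} l {x y} → Occurring b (l ++ O ∷ x) → Occurring b (l ++ I ∷ y) →
                      RightSpecial b l
rightSpecial-branch l p q =
  occurring-++ˡ (l ++ O ∷ []) (occurring-∷ʳ-++ l p) ,
  occurring-++ˡ (l ++ I ∷ []) (occurring-∷ʳ-++ l q)

rightSpecial-suffix : ∀ {b} k {l} → RightSpecial b (k ++ l) → RightSpecial b l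
rightSpecial-suffix []      r = r
rightSpecial-suffix (a ∷ k) r = rightSpecial-suffix k (rightSpecial-tail _ r)

rightSpecial-map-not : ∀ {b} l → RightSpecial b l → RightSpecial (complement b) (map not l)
rightSpecial-map-not l (p , q) =
  subst (Occurring _) (map-++ not l _) (occurring-map⁺ (l ++ I ∷ []) q) ,
  subst (Occurring _) (map-++ not l _) (occurring-map⁺ (l ++ O ∷ []) p)

-- Passing from l01u to l10u leaves the number of ones unchanged, so it can
-- only grow along the lexicographic order.
ones-mono : ∀ {b} → HasCentral b → ∀ m l {x y} → length x ≡ m → x ≼ y →
            Occurring b (l ++ x) → Occurring b (l ++ y) → ones x ≤ ones y
ones-mono K m l e [] p q = z≤n
ones-mono K (suc m) l e (O ∷ h) p q =
  ones-mono K m (l ∷ʳ O) (suc-injective e) h (occurring-∷ʳ-++ l p) (occurring-∷ʳ-++ l q)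
ones-mono K (suc m) l e (I ∷ h) p q =
  s≤s (ones-mono K m (l ∷ʳ I) (suc-injective e) h (occurring-∷ʳ-++ l p) (occurring-∷ʳ-++ l q))
ones-mono K (suc m) l {O ∷ []} e (O≺I d) p q = z≤n
ones-mono {b} K (suc m) l {O ∷ x@(_ ∷ x′)} {I ∷ y} e (O≺I d) p q
  with u , f , c ← K l (rightSpecial-branch l p q) (length x′) = ≤-trans
    (ones-mono K m (l ∷ʳ O) (suc-injective e) (maximal x (cong suc (sym f)) p)
      (occurring-∷ʳ-++ l p) (occurring-∷ʳ-++ l lower))
    (s≤s (ones-mono K m (l ∷ʳ I) (trans (cong suc f) (suc-injective e))
      (minimal y (trans (sym d) (cong suc (sym f))) q)
      (occurring-∷ʳ-++ l upper) (occurring-∷ʳ-++ l q)))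
  where open Central c

-- Without the prefix l, 01u and 10u are still factors; the extremality of 01v and 10v then bounds u
-- from both sides.
central-unique : ∀ {b u v} l → Central b l u → Central b [] v → length u ≡ length v → u ≡ v
central-unique l c d e = ≼-antisym
  (≼-++⁻ʳ (I ∷ []) (maximal d _ (cong suc e) (occurring-++ʳ l (lower c))))
  (≼-++⁻ʳ (O ∷ []) (minimal d _ (cong suc e) (occurring-++ʳ l (upper c))))
  where open Central

-- At most one right special factor of each length

run : ∀ (b : InfiniteWord Bool) c a →
      (∀ k → k < a → b k ≡ c) ⊎ (∃[ k ] (k < a × b k ≡ not c))
run b c zero = inj₁ λ k ()
run b c (suc a) with run b c a
... | inj₂ (k , k<a , e) = inj₂ (k , m<n⇒m<1+n k<a , e)
... | inj₁ h with b a in e | c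
...   | O | I = inj₂ (a , n<1+n a , e)
...   | I | O = inj₂ (a , n<1+n a , e)
...   | O | O = inj₁ λ k k<a → case-< k k<a
  where
  case-< : ∀ k → k < suc a → b k ≡ O
  case-< k (s≤s k≤a) with m≤n⇒m<n∨m≡n k≤a
  ... | inj₁ k<a = h k k<a
  ... | inj₂ refl = e
...   | I | I = inj₁ λ k k<a → case-< k k<a
  where
  case-< : ∀ k → k < suc a → b k ≡ I
  case-< k (s≤s k≤a) with m≤n⇒m<n∨m≡n k≤a
  ... | inj₁ k<a = h k k<a
  ... | inj₂ refl = e

-- Sliding a window to the left until it is preceded by c.
slide : ∀ {b} c (Q : Word Bool → Set) → (∀ z x → Q (z ∷ʳ x) → Q (not c ∷ z)) →
        ∀ a {k} z → k < a → b k ≡ c → At b a z → Q z →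
        ∃[ y ] (length y ≡ length z × Occurring b (c ∷ y) × Q y)
slide {b} c Q step (suc a) {k} z (s≤s k≤a) e p q with b a in f | c | m≤n⇒m<n∨m≡n k≤a | initLast z
... | O | O | _         | _         = z , refl , (a , f , p) , q
... | I | I | _         | _         = z , refl , (a , f , p) , q
... | O | I | inj₂ refl | _         = ⊥-elim (O≢I f e)
... | I | O | inj₂ refl | _         = ⊥-elim (O≢I e f)
... | O | I | inj₁ k<a  | []        = [] , refl , (k , e , tt) , q
... | I | O | inj₁ k<a  | []        = [] , refl , (k , e , tt) , q
... | O | I | inj₁ k<a  | z′ ∷ʳ′ x
  with y , ly , o , r ← slide I Q step a (O ∷ z′) k<a e (f , at-++ˡ z′ p) (step z′ x q) =
  y , trans ly (sym (length-∷ʳ z′)) , o , r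
... | I | O | inj₁ k<a  | z′ ∷ʳ′ x
  with y , ly , o , r ← slide O Q step a (I ∷ z′) k<a e (f , at-++ˡ z′ p) (step z′ x q) =
  y , trans ly (sym (length-∷ʳ z′)) , o , r

at-agree : ∀ {A : Set} {w : InfiniteWord A} {i j} u → At w i u → At w j u →
           ∀ d → d < length u → w (i + d) ≡ w (j + d)
at-agree {w = w} {i} {j} (a ∷ u) (e , p) (f , q) zero    _       =
  trans (cong w (+-identityʳ i)) (trans e (trans (sym f) (cong w (sym (+-identityʳ j)))))
at-agree {w = w} {i} {j} (a ∷ u) (e , p) (f , q) (suc d) (s≤s h) =
  trans (cong w (+-suc i d)) (trans (at-agree u p q d h) (cong w (sym (+-suc j d))))

-- Each letter of the later occurrence equals one at an earlier position, already known to be 0, so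
-- the run of zeros propagates through it.
zeros-through : ∀ {b} q {i j} → i < j → (∀ k → k < j → b k ≡ O) → At b i q → At b j q →
                ∀ k → k < j + length q → b k ≡ O
zeros-through {b} []      {i} {j} i<j h p q k k< = h k (subst (k <_) (+-identityʳ j) k<)
zeros-through {b} (a ∷ u) {i} {j} i<j h (e , p) (f , q) k k< =
  zeros-through u (s≤s i<j) h′ p q k (subst (k <_) (+-suc j (length u)) k<)
  where
  h′ : ∀ k → k < suc j → b k ≡ O
  h′ k (s≤s k≤j) with m≤n⇒m<n∨m≡n k≤j
  ... | inj₁ k<j = h k k<j
  ... | inj₂ refl = trans f (trans (sym e) (h i i<j))

-- Reading u at two adjacent positions makes each of its letters equal to the one before, starting
-- from 0.
ones-shifted-zeros : ∀ {b} i u → At b i (O ∷ u) → At b i u → ones u ≡ 0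
ones-shifted-zeros i []      _       _       = refl
ones-shifted-zeros i (a ∷ u) (e , p) (f , q) with refl ← trans (sym e) f =
  ones-shifted-zeros (suc i) u p q

module _ {b : InfiniteWord Bool} (K : HasCentral b) where

  -- If some 1p1 is preceded by a 0, then every word of length |p| + 2 with at
  -- most as many ones as p can occur only in the initial run of zeros.  Hence
  -- 0p0 pins down w = 0ⁱ⁺¹p01U, and comparing with 10p10U forces U = p10U.
  bispecial-core : ∀ p → RightSpecial b (O ∷ p) → RightSpecial b (I ∷ p) →
                   ∀ {k a} → k < a → b k ≡ O → At b a (I ∷ p ++ I ∷ []) → ⊥
  bispecial-core p r₀ r₁ {k₀} {a₀} k₀<a₀ bk₀ high = absurd
    where
    open Central

    n : ℕ
    n = length p

    rε : RightSpecial b []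
    rε = occurring-++ʳ (O ∷ p) (proj₁ r₀) , occurring-++ʳ (O ∷ p) (proj₂ r₀)

    -- The tails are taken at the empty prefix; `c₀` and `c₁` carry them over to 0p and 1p by
    -- `central-unique`.
    abstract
      u : ℕ → Word Bool
      u m = proj₁ (K [] rε m)

      |u| : ∀ m → length (u m) ≡ m
      |u| m = proj₁ (proj₂ (K [] rε m))

      cε : ∀ m → Central b [] (u m)
      cε m = proj₂ (proj₂ (K [] rε m))

    c₀ : ∀ m → Central b (O ∷ p) (u m)
    c₀ m with v , e , c ← K (O ∷ p) r₀ m =
      subst (Central b (O ∷ p)) (central-unique (O ∷ p) c (cε m) (trans e (sym (|u| m)))) c

    c₁ : ∀ m → Central b (I ∷ p) (u m)
    c₁ m with v , e , c ← K (I ∷ p) r₁ m =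
      subst (Central b (I ∷ p)) (central-unique (I ∷ p) c (cε m) (trans e (sym (|u| m)))) c

    -- Slide 1p1 left to a preceding 0, and `z` left to a preceding 1. The heavy window then follows
    -- 0 and the light one follows 1; the difference of two ones exceeds the extra leading 1,
    -- against `ones-mono`.
    light : ∀ {k a} z → length z ≡ suc (suc n) → ones z ≤ ones p →
            k < a → b k ≡ I → At b a z → ⊥
    light z lz oz k<a bk q =
      let y , ly , oy , hy = slide O (λ z → suc (suc (ones p)) ≤ ones z) heavier
            a₀ (I ∷ p ++ I ∷ []) k₀<a₀ bk₀ high (s≤s (≤-reflexive (sym (ones-∷ʳI p))))
          y′ , ly′ , oy′ , hy′ = slide I (λ z → ones z ≤ ones p) lighter _ z k<a bk q oz
      in <-irrefl refl (≤-trans (≤-trans hy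
        (ones-mono K _ [] refl (O≺I (trans ly (trans (cong suc (length-∷ʳ p)) (sym (trans ly′ lz))))) oy oy′))
        (s≤s hy′))
      where
      heavier : ∀ z x → suc (suc (ones p)) ≤ ones (z ∷ʳ x) → suc (suc (ones p)) ≤ suc (ones z)
      heavier z O h = m≤n⇒m≤1+n (subst (_ ≤_) (ones-∷ʳO z) h)
      heavier z I h = subst (_ ≤_) (ones-∷ʳI z) h
      lighter : ∀ z x → ones (z ∷ʳ x) ≤ ones p → ones z ≤ ones p
      lighter z x h = ≤-trans (m≤m+n _ _) (subst (_≤ ones p) (ones-++ z _) h)

    light-zeros : ∀ {a} z → length z ≡ suc (suc n) → ones z ≤ ones p → At b a z →
                  ∀ k → k < a → b k ≡ O
    light-zeros {a} z lz oz q with run b O a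
    ... | inj₁ h              = h
    ... | inj₂ (k , k<a , bk) = ⊥-elim (light z lz oz k<a bk q)

    0p0-zeros : ∀ {a x} → At b a (O ∷ p ++ O ∷ x) → ∀ k → k < a → b k ≡ O
    0p0-zeros {a} {x} q = light-zeros (O ∷ p ++ O ∷ []) (cong suc (length-∷ʳ p)) (≤-reflexive (ones-∷ʳO p))
      (at-++ˡ (O ∷ p ++ O ∷ []) (subst (At b a) (cong (O ∷_) (sym (∷ʳ-++ p O x))) q))

    -- Everything before `j` is 0, so the occurrence of 0p0 at `j` would extend the zeros over the 1
    -- that follows 0p0 at `i`.
    same-place : ∀ {i j x y} → At b i (O ∷ p ++ O ∷ I ∷ x) → At b j (O ∷ p ++ O ∷ I ∷ y) → ¬ i < j
    same-place {i} {j} {x} {y} q r i<j =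
      O≢I (zeros-through (O ∷ p ++ O ∷ []) i<j (0p0-zeros r)
             (at-++ˡ (O ∷ p ++ O ∷ []) q′) (at-++ˡ (O ∷ p ++ O ∷ []) r′)
             _ (+-monoˡ-< _ i<j))
          (proj₁ (at-++ʳ (O ∷ p ++ O ∷ []) q′))
      where
      q′ = subst (At b i) (cong (O ∷_) (sym (∷ʳ-++ p O (I ∷ x)))) q
      r′ = subst (At b j) (cong (O ∷_) (sym (∷ʳ-++ p O (I ∷ y)))) r

    abstract
      i : ℕ
      i = proj₁ (lower (c₀ 0))

      -- One position serves every `m`, so all the words `u m` are prefixes of a single infinite
      -- word.
      0p01-at : ∀ m → At b i (O ∷ p ++ O ∷ I ∷ u m)
      0p01-at m with j , q ← lower (c₀ m) with <-cmp i j
      ... | tri< i<j _ _  = ⊥-elim (same-place (proj₂ (lower (c₀ 0))) q i<j)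
      ... | tri≈ _ refl _ = q
      ... | tri> _ _ j<i  = ⊥-elim (same-place q (proj₂ (lower (c₀ 0))) j<i)

    -- The position of the 01 that follows 0p; the words `u m` start at `s + 2`.
    s : ℕ
    s = i + suc n

    01-at : ∀ m → At b s (O ∷ I ∷ u m)
    01-at m = at-++ʳ (O ∷ p) (0p01-at m)

    bs : b (suc s) ≡ I
    bs = proj₁ (proj₂ (01-at 0))

    u-at : ∀ m → At b (suc (suc s)) (u m)
    u-at m = proj₂ (proj₂ (01-at m))

    zeros-to-i : ∀ k → k ≤ i → b k ≡ O
    zeros-to-i k k≤i with m≤n⇒m<n∨m≡n k≤i
    ... | inj₁ k<i  = 0p0-zeros (0p01-at 0) k k<i
    ... | inj₂ refl = proj₁ (0p01-at 0)

    -- The 1 that begins 1p01u lies after `i`, since all letters up to `i` are 0. The 01 in it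
    -- therefore starts after `s`, and not at `s + 1`, which holds a 1.
    recurrence : ∀ m → ∃[ d ] At b (suc (suc s) + d) (O ∷ I ∷ u m)
    recurrence m with a , e , q ← lower (c₁ m) =
      d , subst (λ j → At b j (O ∷ I ∷ u m)) (sym d≡) 01u
      where
      01u : At b (a + suc n) (O ∷ I ∷ u m)
      01u = at-++ʳ (I ∷ p) (e , q)
      i<a : i < a
      i<a = ≰⇒> λ a≤i → O≢I (zeros-to-i a a≤i) e
      s<a : s < a + suc n
      s<a = +-monoˡ-< (suc n) i<a
      le : suc (suc s) ≤ a + suc n
      le with m≤n⇒m<n∨m≡n s<a
      ... | inj₁ h = h
      ... | inj₂ h = ⊥-elim (O≢I (trans (cong b h) (proj₁ 01u)) bs)
      d = proj₁ (m≤n⇒∃[o]m+o≡n le)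
      d≡ : suc (suc s) + d ≡ a + suc n
      d≡ = proj₂ (m≤n⇒∃[o]m+o≡n le)

    -- The letter before 0p10u has to be 1: a 0 there, with a 1 somewhere earlier, makes 00p too
    -- light, and an occurrence preceded by zeros only is incompatible with 0p01u at `i`.
    10p10 : ∀ m → suc n ≤ m → Occurring b (I ∷ O ∷ p ++ I ∷ O ∷ u m)
    10p10 m n<m with upper (c₀ m)
    10p10 m n<m | a , q with run b O a
    10p10 m n<m | suc a , q | inj₂ (k , s≤s k≤a , bk) with b a in e
    ... | I = a , e , q
    ... | O with m≤n⇒m<n∨m≡n k≤a
    ...   | inj₁ k<a  = ⊥-elim (light (O ∷ O ∷ p) refl ≤-refl k<a bk (e , at-++ˡ (O ∷ p) q))
    ...   | inj₂ refl = ⊥-elim (O≢I e bk)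
    10p10 m n<m | a , q | inj₁ h with <-cmp i a
    ... | tri≈ _ refl _ = ⊥-elim (O≢I (proj₁ (01-at 0)) (proj₁ (at-++ʳ (O ∷ p) q)))
    ... | tri> _ _ a<i  = ⊥-elim (O≢I
      (zeros-through (O ∷ p) a<i (0p0-zeros (0p01-at 0)) (at-++ˡ (O ∷ p) q) (at-++ˡ (O ∷ p) (0p01-at 0))
        _ (+-monoˡ-< (suc n) a<i))
      (proj₁ (at-++ʳ (O ∷ p) q)))
    ... | tri< i<a _ _ with m≤n⇒m<n∨m≡n i<a
    ...   | inj₁ i+1<a = ⊥-elim (O≢I
      (zeros-through (O ∷ p) i<a h (at-++ˡ (O ∷ p) (0p01-at 0)) (at-++ˡ (O ∷ p) q)
        _ (+-monoˡ-< (suc n) i+1<a))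
      bs)
    -- Now 0p occurs at `i` and `i + 1`, so `u m` is read at `s + 2` and at `s + 3`, with a 0 at
    -- `s + 2`. Its first |p| + 1 letters are 0, which gives too light a word right after the 1 at
    -- `s + 1`.
    ...   | inj₂ refl with n′ , e ← m≤n⇒∃[o]m+o≡n n<m
        with u₁ , u₂ , e₁ , l₁ , _ ← split-at (suc n) (u m) (trans (|u| m) (sym e)) =
      ⊥-elim (light (O ∷ u₁) (cong suc l₁) (subst (_≤ ones p) (sym no-ones) z≤n) (n<1+n (suc s)) bs 0u₁)
      where
      0u₁ : At b (suc (suc s)) (O ∷ u₁)
      0u₁ = at-++ˡ (O ∷ u₁) (subst (λ v → At b (suc (suc s)) (O ∷ v)) e₁ (proj₂ (at-++ʳ (O ∷ p) q)))
      no-ones : ones u₁ ≡ 0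
      no-ones = ones-shifted-zeros (suc (suc s)) u₁ 0u₁
        (at-++ˡ u₁ (subst (At b (suc (suc s))) e₁ (u-at m)))

    -- The length of `p ++ I ∷ O ∷ u k`.
    m⁺ : ℕ → ℕ
    m⁺ k = suc n + suc k

    -- Let t be the prefix of length |p| + 1 of the right side. As 0t follows a 1, it has more ones
    -- than p, so monotonicity puts t above p0, hence at p1 or higher. If t = p1, then 0p1 occurs
    -- and `minimal (c₀ k)` bounds the rest.
    lower-bound : ∀ k → p ++ I ∷ O ∷ u k ≼ u (m⁺ k)
    lower-bound k with t , v , e , lt , lv ← split-at (suc n) (u (m⁺ k)) (|u| (m⁺ k)) =
      subst₂ _≼_ (∷ʳ-++ p I (O ∷ u k)) (sym e)
        (≼-++ p1≼t (trans (cong suc (|u| k)) (sym lv)) tail-bound)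
      where
      10tv : Occurring b (I ∷ O ∷ t ++ v)
      10tv = subst (λ x → Occurring b (I ∷ O ∷ x)) e (upper (cε (m⁺ k)))
      heavy : ¬ ones t ≤ ones p
      heavy h with a , ba , q ← 10tv = light (O ∷ t) (cong suc lt) h (n<1+n a) ba (at-++ˡ (O ∷ t) q)
      p1≼t : p ++ I ∷ [] ≼ t
      p1≼t with ≼-total t (p ++ O ∷ []) (trans lt (sym (length-∷ʳ p)))
      ... | inj₁ h = ⊥-elim (heavy (subst (ones t ≤_) (ones-∷ʳO p)
        (ones-mono K _ [] refl (O ∷ h)
          (occurring-++ˡ (O ∷ t) (occurring-++ʳ (I ∷ []) 10tv)) (proj₁ r₀))))
      ... | inj₂ h with ≼-∷ʳO p h
      ...   | inj₁ refl = ⊥-elim (heavy (≤-reflexive (ones-∷ʳO p)))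
      ...   | inj₂ h′   = h′
      tail-bound : p ++ I ∷ [] ≡ t → O ∷ u k ≼ v
      tail-bound refl = minimal (c₀ k) v (trans lv (cong suc (sym (|u| k))))
        (subst (Occurring b) (cong (O ∷_) (∷ʳ-++ p I v)) (occurring-++ʳ (I ∷ []) 10tv))

    -- The inequality opposite to `lower-bound` holds because 10p10u is a factor, while 10u is the
    -- least one beginning with 1.
    periodic : ∀ k → suc n ≤ k → u (m⁺ k) ≡ p ++ I ∷ O ∷ u k
    periodic k n<k = ≼-antisym
      (≼-++⁻ʳ (O ∷ []) (minimal (cε (m⁺ k)) _ len (10p10 k n<k)))
      (lower-bound k)
      where
      len : suc (length (p ++ I ∷ O ∷ u k)) ≡ suc (length (u (m⁺ k)))
      len = cong suc (≼-length (lower-bound k))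

    absurd : ⊥
    -- The recurrence puts 01p1 at `s + 2 + d`: a 0 there and a 1 at distance |p| + 2. But `u k`
    -- occurs at `s + 2` and again |p| + 2 later, and `k` exceeds `d`, so these two letters agree.
    absurd with d , e , _ , q ← recurrence (m⁺ (suc n)) = O≢I
      (trans (cong b (+-comm-assoc s n d))
        (trans (at-agree (u k)
                 (proj₂ (proj₂ (at-++ʳ p
                   (subst (At b (suc (suc s))) (periodic k (m≤m+n (suc n) _)) (u-at (m⁺ k))))))
                 (u-at k) d (subst (d <_) (sym (|u| k)) (m<n+m d (s≤s z≤n))))
               e))
      (proj₁ (at-++ʳ p (subst (At b _) (periodic (suc n) ≤-refl) q)))
      where
      k = suc n + d
      +-comm-assoc : ∀ s n d → suc (suc (suc (suc (s + d)))) + n ≡ suc (suc (suc (suc s) + n)) + d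
      +-comm-assoc s n d = cong (λ x → suc (suc (suc (suc x))))
        (trans (+-assoc s d n) (trans (cong (s +_) (+-comm d n)) (sym (+-assoc s n d))))


-- A 0 before 1p1 is the core case, and a 1 before 0p0 is its complement. If neither exists, the
-- first letter of the word would be both 1 and 0.
no-bispecial : ∀ {b} → HasCentral b → ∀ p → RightSpecial b (O ∷ p) → RightSpecial b (I ∷ p) → ⊥
no-bispecial {b} K p r₀ r₁ with a₁ , q₁ ← proj₂ r₁ | a₀ , q₀ ← proj₁ r₀ with run b I a₁ | run b O a₀
... | inj₂ (k , k<a , e) | _ = bispecial-core K p r₀ r₁ k<a e q₁
... | inj₁ _ | inj₂ (k , k<a , e) =
  bispecial-core (hasCentral-complement K) (map not p)
    (rightSpecial-map-not (I ∷ p) r₁) (rightSpecial-map-not (O ∷ p) r₀) k<a (cong not e)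
    (subst (At (complement b) a₀) (cong (I ∷_) (map-++ not p (O ∷ []))) (at-map⁺ (O ∷ p ++ O ∷ []) q₀))
... | inj₁ h | inj₁ h′ = O≢I (at-zero a₀ (proj₁ q₀) h′) (at-zero a₁ (proj₁ q₁) h)
  where
  at-zero : ∀ {c} a → b a ≡ c → (∀ k → k < a → b k ≡ c) → b 0 ≡ c
  at-zero zero    e h = e
  at-zero (suc a) e h = h 0 (s≤s z≤n)

-- Suffixes of right special factors are right special, so by induction two of them could differ
-- only in the first letter.
rightSpecial-unique : ∀ {b} → HasCentral b → ∀ l l′ → length l ≡ length l′ →
                      RightSpecial b l → RightSpecial b l′ → l ≡ l′
rightSpecial-unique K []      []       e r r′ = refl
rightSpecial-unique K (a ∷ l) (a′ ∷ l′) e r r′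
  with refl ← rightSpecial-unique K l l′ (suc-injective e) (rightSpecial-tail l r) (rightSpecial-tail l′ r′)
  with a | a′
... | O | O = refl
... | I | I = refl
... | O | I = ⊥-elim (no-bispecial K l r r′)
... | I | O = ⊥-elim (no-bispecial K l r′ r)

-- The step from l01u to l10u keeps the number of ones, so the rise from x to y lies inside one of
-- the two branches. Following it down leads to two words that differ only in their last letter.
rightSpecial-between : ∀ {b} → HasCentral b → ∀ m l {x y} → length x ≡ m → length y ≡ m → ones x < ones y →
                       Occurring b (l ++ x) → Occurring b (l ++ y) →
                       ∃[ r ] (suc (length r) ≡ length l + m × RightSpecial b r)
rightSpecial-between K (suc m) l {O ∷ x} {O ∷ y} e f h p q
  with r , g , s ← rightSpecial-between K m (l ∷ʳ O) (suc-injective e) (suc-injective f) h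
         (occurring-∷ʳ-++ l p) (occurring-∷ʳ-++ l q) =
  r , trans g (trans (cong (_+ m) (length-∷ʳ l)) (sym (+-suc _ m))) , s
rightSpecial-between K (suc m) l {I ∷ x} {I ∷ y} e f (s≤s h) p q
  with r , g , s ← rightSpecial-between K m (l ∷ʳ I) (suc-injective e) (suc-injective f) h
         (occurring-∷ʳ-++ l p) (occurring-∷ʳ-++ l q) =
  r , trans g (trans (cong (_+ m) (length-∷ʳ l)) (sym (+-suc _ m))) , s
rightSpecial-between K (suc m) l {I ∷ x} {O ∷ y} e f h p q =
  ⊥-elim (<⇒≱ h (ones-mono K (suc m) l f (O≺I (suc-injective (trans f (sym e)))) q p))
rightSpecial-between K (suc m) l {O ∷ []} {I ∷ y} e f h p q =
  l , trans (+-comm 1 (length l)) (cong (length l +_) e) ,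
  rightSpecial-branch l p q
rightSpecial-between K (suc m) l {O ∷ x@(_ ∷ x′)} {I ∷ y} e f h p q
  with u , lu , c ← K l (rightSpecial-branch l p q) (length x′)
  with ones x <? suc (ones u) | ones u <? ones y
... | yes h′ | _
  with r , g , s ← rightSpecial-between K m (l ∷ʳ O) (suc-injective e)
         (trans (cong suc lu) (suc-injective e)) h′
         (occurring-∷ʳ-++ l p) (occurring-∷ʳ-++ l (Central.lower c)) =
  r , trans g (trans (cong (_+ m) (length-∷ʳ l)) (sym (+-suc _ m))) , s
... | no _ | yes h′
  with r , g , s ← rightSpecial-between K m (l ∷ʳ I) (trans (cong suc lu) (suc-injective e))
         (suc-injective f) h′
         (occurring-∷ʳ-++ l (Central.upper c)) (occurring-∷ʳ-++ l q) =
  r , trans g (trans (cong (_+ m) (length-∷ʳ l)) (sym (+-suc _ m))) , s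
... | no h₁ | no h₂ = ⊥-elim (<⇒≱ h (≤-trans (s≤s (≮⇒≥ h₂)) (≮⇒≥ h₁)))

-- The central pair 01u, 10u of the empty word contains 0u and 1u, between which the number of ones
-- rises.
rightSpecial-exists : ∀ {b} → HasCentral b → RightSpecial b [] → ∀ n →
                      ∃[ r ] (length r ≡ n × RightSpecial b r)
rightSpecial-exists K rε n
  with u , refl , c ← K [] rε n
  with r , e , s ← rightSpecial-between K (suc (length u)) [] refl refl (n<1+n (ones u))
         (occurring-++ʳ (I ∷ []) (Central.upper c)) (occurring-++ʳ (O ∷ []) (Central.lower c)) =
  r , suc-injective e , s

-- Right special factors and complexity

pigeonhole : ∀ {A : Set} (us : List A) {m} → length us < m → (f : Fin m → A) → (∀ i → f i ∈ us) →
             ∃[ i ] ∃[ j ] (i <ᶠ j × f i ≡ f j)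
pigeonhole us us<m f f∈us with i , j , i<j , e ← Fin.pigeonhole us<m (λ i → index (f∈us i)) =
  i , j , i<j , Membership.index-injective (setoid _) (f∈us i) (f∈us j) e

unique-lookup : ∀ {A : Set} {us : List A} → Unique us → ∀ i j → i <ᶠ j → lookup us i ≢ lookup us j
unique-lookup {us = u ∷ us} (h ∷ _) zero    (suc j) _         = All.lookup h (∈-lookup {xs = us} j)
unique-lookup               (_ ∷ h) (suc i) (suc j) (s≤s i<j) = unique-lookup h i j i<j

unique-length : ∀ {A : Set} {us vs : List A} → Unique us → (∀ {u} → u ∈ us → u ∈ vs) →
                length us ≤ length vs
unique-length {us = us} {vs} h sub = ≮⇒≥ λ vs<us →
  let i , j , i<j , e = pigeonhole vs vs<us (lookup us) (λ i → sub (∈-lookup {xs = us} i))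
  in unique-lookup h i j i<j e

module Extension (em : ExcludedMiddle 0ℓ) (b : InfiniteWord Bool) where

  -- Preferring 0 is a convention: each factor gets one default extension, and the only other
  -- factors one letter longer are r1 with r right special.
  next : Word Bool → Bool
  next u with em {Occurring b (u ∷ʳ O)}
  ... | yes _ = O
  ... | no  _ = I

  extend : Word Bool → Word Bool
  extend u = u ∷ʳ next u

  extend-injective : ∀ {u v} → extend u ≡ extend v → u ≡ v
  extend-injective {u} {v} = ∷ʳ-injectiveˡ u v

  extend-occurring : ∀ u → Occurring b u → Occurring b (extend u)
  extend-occurring u p with em {Occurring b (u ∷ʳ O)}
  ... | yes q = q
  ... | no ¬q with occurring-extend u p 1
  ...   | O ∷ [] , _ , q = contradiction q ¬q
  ...   | I ∷ [] , _ , q = q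

  extend-rightSpecial : ∀ {u v} → RightSpecial b u → u ∷ʳ I ≢ extend v
  extend-rightSpecial {u} {v} r e with ∷ʳ-injectiveˡ u v e
  ... | refl with em {Occurring b (u ∷ʳ O)} | ∷ʳ-injectiveʳ u u e
  ...   | no ¬q | _ = ¬q (proj₁ r)

  extend-or-rightSpecial : ∀ u a → Occurring b (u ∷ʳ a) →
                           u ∷ʳ a ≡ extend u ⊎ a ≡ I × RightSpecial b u
  extend-or-rightSpecial u a p with em {Occurring b (u ∷ʳ O)} | a
  ... | yes q | O = inj₁ refl
  ... | yes q | I = inj₂ (refl , q , p)
  ... | no ¬q | O = contradiction p ¬q
  ... | no ¬q | I = inj₁ refl

  new-unique : ∀ {us r} → RightSpecial b r → Unique us → Unique (r ∷ʳ I ∷ map extend us)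
  new-unique r h = All.tabulate (λ v∈ e → let _ , _ , f = ∈-map⁻ extend v∈ in
    extend-rightSpecial r (trans e f)) ∷ Unique.map⁺ extend-injective h

module Counting (em : ExcludedMiddle 0ℓ) (b : InfiniteWord Bool) where

  open Extension em b

  -- The factors of length n + 1 are the default extensions of those of length n, together with the
  -- single extra word r1.
  sturmian-rightSpecial : (∀ n → ∃[ r ] (length r ≡ n × RightSpecial b r)) →
    (∀ l l′ → length l ≡ length l′ → RightSpecial b l → RightSpecial b l′ → l ≡ l′) → Sturmian b
  sturmian-rightSpecial exist uniq zero =
    [] ∷ [] , refl , [] ∷ [] , λ where
      []      → mk⇔ (λ _ → (0 , refl) , refl) (λ _ → here refl)
      (a ∷ u) → mk⇔ (λ { (here ()) ; (there ()) }) (λ { (_ , ()) })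
  sturmian-rightSpecial exist uniq (suc n)
    with us , len , unique , members ← sturmian-rightSpecial exist uniq n | r , refl , special ← exist n =
    r ∷ʳ I ∷ map extend us ,
    cong suc (trans (length-map extend us) len) ,
    new-unique special unique ,
    λ v → mk⇔ sound (complete v)
    where
    sound : ∀ {v} → v ∈ r ∷ʳ I ∷ map extend us → Factor b v × length v ≡ suc n
    sound (here refl) = occurring⇒factor _ (proj₂ special) , length-∷ʳ r
    sound (there v∈) with u , u∈ , refl ← ∈-map⁻ extend v∈
      with f , e ← Equivalence.to (members u) u∈ =
      occurring⇒factor _ (extend-occurring u (factor⇒occurring u f)) , trans (length-∷ʳ u) (cong suc e)
    complete : ∀ v → Factor b v × length v ≡ suc n → v ∈ r ∷ʳ I ∷ map extend us
    complete v (f , e) with initLast v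
    ... | u ∷ʳ′ a with extend-or-rightSpecial u a (factor⇒occurring _ f)
    ...   | inj₂ (refl , r′) =
      here (cong (_∷ʳ I) (uniq u r (suc-injective (trans (sym (length-∷ʳ u)) e)) r′ special))
    ...   | inj₁ g = there (subst (_∈ map extend us) (sym g) (∈-map⁺ extend (Equivalence.from (members u)
      (occurring⇒factor u (occurring-++ˡ u (factor⇒occurring {w = b} _ f)) ,
       suc-injective (trans (sym (length-∷ʳ u)) e)))))

  module _ (st : Sturmian b) where

    -- The n + 2 factors of length n + 1 have only n + 1 prefixes of length n, so two of them share
    -- one.
    sturmian-exists : ∀ n → ∃[ r ] (length r ≡ n × RightSpecial b r)
    sturmian-exists n
      with us , len , unique , members ← st n | vs , len′ , unique′ , members′ ← st (suc n) =
      let i , j , i<j , e = pigeonhole us (≤-reflexive (trans (cong suc len) (sym len′)))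
                              (proj₁ ∘ parent) (proj₁ ∘ proj₂ ∘ parent)
      in branch i j (unique-lookup unique′ i j i<j) e
      where
      parent : ∀ i → ∃[ u ] (u ∈ us × ∃[ a ] lookup vs i ≡ u ∷ʳ a)
      parent i with lookup vs i | Equivalence.to (members′ _) (∈-lookup {xs = vs} i)
      ... | v | f , e with initLast v
      ...   | u ∷ʳ′ a = u , Equivalence.from (members u)
        (occurring⇒factor u (occurring-++ˡ u (factor⇒occurring {w = b} _ f)) ,
         suc-injective (trans (sym (length-∷ʳ u)) e)) , a , refl
      branch : ∀ i j → lookup vs i ≢ lookup vs j → proj₁ (parent i) ≡ proj₁ (parent j) →
               ∃[ r ] (length r ≡ n × RightSpecial b r)
      branch i j ne e with parent i | parent j
      ... | u , u∈ , a , f | _ , _ , a′ , f′ with refl ← e =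
        u , proj₂ (Equivalence.to (members u) u∈) , special a a′ (λ g → ne (trans f (trans (cong (u ∷ʳ_) g) (sym f′))))
              (subst (Occurring b) f (occ i)) (subst (Occurring b) f′ (occ j))
        where
        occ : ∀ i → Occurring b (lookup vs i)
        occ i = factor⇒occurring _ (proj₁ (Equivalence.to (members′ _) (∈-lookup {xs = vs} i)))
        special : ∀ a a′ → a ≢ a′ → Occurring b (u ∷ʳ a) → Occurring b (u ∷ʳ a′) → RightSpecial b u
        special O O ne p q = contradiction refl ne
        special O I ne p q = p , q
        special I O ne p q = q , p
        special I I ne p q = contradiction refl ne

    -- Otherwise l1 and l′1, added to the n + 1 default extensions, would make n + 3 factors of
    -- length n + 1.
    sturmian-unique : ∀ l l′ → length l ≡ length l′ → RightSpecial b l → RightSpecial b l′ → l ≡ l′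
    sturmian-unique l l′ e r r′
      with us , len , unique , members ← st (length l) | vs , len′ , unique′ , members′ ← st (suc (length l))
      with em {l ≡ l′}
    ... | yes l≡l′ = l≡l′
    ... | no l≢l′ = contradiction
      (subst₂ _≤_ (cong (λ k → suc (suc k)) (trans (length-map extend us) len)) len′ (unique-length new sub)) (<-irrefl refl)
      where
      new : Unique (l ∷ʳ I ∷ l′ ∷ʳ I ∷ map extend us)
      new with h ∷ hs ← new-unique r unique = ((l≢l′ ∘ ∷ʳ-injectiveˡ l l′) ∷ h) ∷ new-unique r′ unique
      sub : ∀ {v} → v ∈ l ∷ʳ I ∷ l′ ∷ʳ I ∷ map extend us → v ∈ vs
      sub (here refl)         = Equivalence.from (members′ _) (occurring⇒factor _ (proj₂ r) , length-∷ʳ l)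
      sub (there (here refl)) = Equivalence.from (members′ _)
        (occurring⇒factor _ (proj₂ r′) , trans (length-∷ʳ l′) (cong suc (sym e)))
      sub (there (there v∈)) with u , u∈ , refl ← ∈-map⁻ extend v∈
        with f , g ← Equivalence.to (members u) u∈ = Equivalence.from (members′ _)
          (occurring⇒factor _ (extend-occurring u (factor⇒occurring u f)) , trans (length-∷ʳ u) (cong suc g))

-- Balance

OneRightSpecial : InfiniteWord Bool → Set
OneRightSpecial b = (∀ n → ∃[ r ] (length r ≡ n × RightSpecial b r)) ×
  (∀ l l′ → length l ≡ length l′ → RightSpecial b l → RightSpecial b l′ → l ≡ l′)

oneRightSpecial-complement : ∀ {b} → OneRightSpecial b → OneRightSpecial (complement b)
oneRightSpecial-complement {b} (exist , uniq) =
  (λ n → let r , e , s = exist n in map not r , trans (length-map not r) e , rightSpecial-map-not r s) ,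
  (λ l l′ e s s′ → map-injective not-injective (uniq (map not l) (map not l′)
    (trans (length-map not l) (trans e (sym (length-map not l′))))
    (rightSpecial-complement l s) (rightSpecial-complement l′ s′)))

Unbalanced : InfiniteWord Bool → Word Bool → Set
Unbalanced b p = Occurring b (O ∷ p ++ O ∷ []) × Occurring b (I ∷ p ++ I ∷ [])

unbalanced-complement : ∀ {b} p → Unbalanced (complement b) p → Unbalanced b (map not p)
unbalanced-complement {b} p (q , r) =
  subst (Occurring b) (cong (O ∷_) (map-++ not p _)) (occurring-complement (I ∷ p ++ I ∷ []) r) ,
  subst (Occurring b) (cong (I ∷_) (map-++ not p _)) (occurring-complement (O ∷ p ++ O ∷ []) q)

unbalanced-map-not : ∀ {b} p → Unbalanced b p → Unbalanced (complement b) (map not p)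
unbalanced-map-not {b} p (q , r) =
  subst (Occurring _) (cong (O ∷_) (map-++ not p _)) (occurring-map⁺ (I ∷ p ++ I ∷ []) r) ,
  subst (Occurring _) (cong (I ∷_) (map-++ not p _)) (occurring-map⁺ (O ∷ p ++ O ∷ []) q)

module Balance (em : ExcludedMiddle 0ℓ) where

  -- After an occurrence of 1p1 the factor 0p stays away for |p| + 2 positions,
  -- long enough for the word to become periodic without meeting 0p again.
  unbalanced-core : ∀ {b} → OneRightSpecial b → ∀ p →
    (∀ t → length t < length p → ¬ Unbalanced b t) → Unbalanced b p → ¬ RightSpecial b (O ∷ p)
  unbalanced-core {b} (exist , uniq) p IH (0p0 , i , 1p1) special = absurd
    where
    n : ℕ
    n = suc (length p)

    -- Both ends of 1p1 are 1. If 0p starts at an inner 0, with p = r0t, then t1 is a prefix of p.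
    -- So 1p begins with 1t1 and 0p0 ends with 0t0, a shorter unbalanced pair.
    absent : ∀ k → k ≤ n → ¬ At b (i + k) (O ∷ p)
    absent zero    _        (e , _) = O≢I (trans (cong b (sym (+-identityʳ i))) e) (proj₁ 1p1)
    absent (suc k) (s≤s k≤) q with m≤n⇒m<n∨m≡n k≤
    ... | inj₂ refl = O≢I (proj₁ q) (proj₁ (at-++ʳ (I ∷ p) 1p1))
    ... | inj₁ k< with d , d≡ ← m≤n⇒∃[o]m+o≡n k<
                  with split-at k p (trans (sym d≡) (sym (+-suc k d)))
    ...   | r , x ∷ t , refl , refl , e
      with f , g ← at-++ʳ (I ∷ r) (subst (λ v → At b i (I ∷ v)) (++-assoc r (x ∷ t) (I ∷ [])) 1p1)
      with refl ← trans (sym f) (proj₁ q)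
      with p′ , e′ ← at-prefix (t ++ I ∷ []) (r ++ O ∷ t) g (proj₂ q)
                      (subst₂ _≤_ (sym (length-∷ʳ t)) (sym (length-++ r)) (m≤n+m (suc (length t)) (length r))) =
      IH t (subst (length t <_) (sym (length-++ r)) (m≤n+m (suc (length t)) (length r)))
        ( occurring-++ʳ (O ∷ r) (subst (λ v → Occurring b (O ∷ v)) (++-assoc r (O ∷ t) (O ∷ [])) 0p0)
        , occurring-++ˡ (I ∷ t ++ I ∷ []) (subst (λ v → Occurring b (I ∷ v)) e′
            (occurring-++ˡ (I ∷ r ++ O ∷ t) (i , 1p1))))

    -- n + 2 words, hence two equal ones, among the n + 1 factors of length n.
    words : Fin (suc (suc n)) → Word Bool
    words zero    = O ∷ p
    words (suc j) = window b (i + toℕ j) n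

    -- W occurs at a and at a + d + 1, and 0p at none of a, …, a + d + 1.
    Loop : ℕ → ℕ → Set
    Loop d a = ∃[ W ] (length W ≡ n × At b a W × At b (suc d + a) W ×
                       (∀ e → e ≤ suc d → ¬ At b (e + a) (O ∷ p)))

    loop-exists : ∃[ d ] ∃[ a ] Loop d a
    loop-exists with us , len , _ , members ← Counting.sturmian-rightSpecial em b exist uniq n =
      found (pigeonhole us (≤-reflexive (cong suc len)) words member)
      where
      member : ∀ j → words j ∈ us
      member zero    = Equivalence.from (members _) (occurring⇒factor (O ∷ p)
        (occurring-++ˡ (O ∷ p) (proj₁ special)) , refl)
      member (suc j) = Equivalence.from (members _) (occurring⇒factor (window b (i + toℕ j) n)
        (_ , window-at b (i + toℕ j) n) , length-window b (i + toℕ j) n)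
      found : ∃[ j ] ∃[ k ] (j <ᶠ k × words j ≡ words k) → ∃[ d ] ∃[ a ] Loop d a
      -- By `absent` no window equals 0p, so the coincidence is between two windows.
      found (zero , suc k , _ , e) = contradiction
        (subst (At b (i + toℕ k)) (sym e) (window-at b (i + toℕ k) n))
        (absent (toℕ k) (≤-pred (Fin.toℕ<n k)))
      found (suc j , suc k , s≤s j<k , e) with d , d≡ ← m≤n⇒∃[o]m+o≡n j<k =
        d , i + toℕ j , window b (i + toℕ j) n , length-window b (i + toℕ j) n ,
        window-at b (i + toℕ j) n ,
        subst₂ (At b) (trans (cong (i +_) (sym d≡)) (shift (toℕ j) d)) (sym e) (window-at b (i + toℕ k) n) ,
        λ c c≤ q → absent (toℕ j + c) (≤-trans (+-monoʳ-≤ (toℕ j) c≤)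
            (subst (_≤ n) (trans (sym d≡) (sym (+-suc (toℕ j) d))) (≤-pred (Fin.toℕ<n k))))
          (subst (λ x → At b x (O ∷ p)) (trans (+-comm c (i + toℕ j)) (+-assoc i (toℕ j) c)) q)
        where
        shift : ∀ j d → i + (suc j + d) ≡ suc d + (i + j)
        shift j d = trans (cong (i +_) (+-comm (suc j) d))
          (trans (cong (i +_) (+-suc d j))
            (trans (sym (+-assoc i (suc d) j))
              (trans (cong (_+ j) (+-comm i (suc d))) (+-assoc (suc d) i j))))

    -- The repeated word differs from 0p, hence is not right special, and both occurrences continue
    -- with the same letter. Were 0p at the new end, it would equal the shifted word and so occur at
    -- `suc a` too.
    loop-step : ∀ d a → Loop d a → Loop d (suc a)
    loop-step d a (c ∷ W , len , p₁ , p₂ , away) = W ∷ʳ x ,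
      trans (length-∷ʳ W) len ,
      at-x ,
      subst (λ k → At b k (W ∷ʳ x)) (sym (+-suc (suc d) a)) at-y ,
      away′
      where
      x y : Bool
      x = b (a + suc (length W))
      y = b (suc d + a + suc (length W))
      full-x : At b a (c ∷ W ∷ʳ x)
      full-x = at-++ (c ∷ W) p₁ (refl , tt)
      full-y : At b (suc d + a) (c ∷ W ∷ʳ y)
      full-y = at-++ (c ∷ W) p₂ (refl , tt)
      not-special : ¬ RightSpecial b (c ∷ W)
      not-special s = away 0 z≤n (subst (At b a) (uniq (c ∷ W) (O ∷ p) len s special) p₁)
      same : ∀ x y → At b a (c ∷ W ∷ʳ x) → At b (suc d + a) (c ∷ W ∷ʳ y) → x ≡ y
      same O O q r = refl
      same I I q r = refl
      same O I q r = contradiction ((_ , q) , (_ , r)) not-special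
      same I O q r = contradiction ((_ , r) , (_ , q)) not-special
      at-x : At b (suc a) (W ∷ʳ x)
      at-x = proj₂ full-x
      at-y : At b (suc (suc d + a)) (W ∷ʳ x)
      at-y = subst (λ z → At b (suc (suc d + a)) (W ∷ʳ z)) (sym (same x y full-x full-y)) (proj₂ full-y)
      away′ : ∀ e → e ≤ suc d → ¬ At b (e + suc a) (O ∷ p)
      away′ e e≤ q with q′ ← subst (λ k → At b k (O ∷ p)) (+-suc e a) q | m≤n⇒m<n∨m≡n e≤
      ... | inj₁ e< = away (suc e) e< q′
      ... | inj₂ refl = away 1 (s≤s z≤n) (subst (At b (suc a))
        (at-unique (W ∷ʳ x) (O ∷ p) at-y q′ (trans (length-∷ʳ W) len)) at-x)

    loop-forever : ∀ d a → Loop d a → ∀ k → Loop d (k + a)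
    loop-forever d a L zero    = L
    loop-forever d a L (suc k) = loop-step d (k + a) (loop-forever d a L k)

    absurd : ⊥
    absurd with d , a , L ← loop-exists
      -- By uniqueness this right special factor ends in 0p. Wherever it occurs, at `q` say, 0p
      -- stands at `q + a`, which the loop moved by `q` excludes.
      with σ , len , s ← exist (a + n)
      with t , r , refl , refl , lr ← split-at a σ len
      with refl ← uniq r (O ∷ p) lr (rightSpecial-suffix t s) special
      with q , o ← occurring-++ˡ (t ++ O ∷ p) (proj₁ s)
      with _ , _ , _ , _ , away ← loop-forever d (length t) L q = away 0 z≤n (at-++ʳ t o)

  -- Since p0 and p1 occur, p is right special, so the right special factor of length |p| + 1 is 0p
  -- or 1p; complementation exchanges the two cases. The bound `n` drives the induction on |p|.
  no-unbalanced : ∀ n {b} → OneRightSpecial b → ∀ p → length p < n → ¬ Unbalanced b p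
  no-unbalanced (suc n) {b} h@(exist , uniq) p (s≤s p≤n) u
    with exist (suc (length p))
  ... | a ∷ r , e , s
    with refl ← uniq r p (suc-injective e) (rightSpecial-tail r s)
           (occurring-++ʳ (O ∷ []) (proj₁ u) , occurring-++ʳ (I ∷ []) (proj₂ u))
    with a
  ... | O = unbalanced-core h p
    (λ t t<p → no-unbalanced n h t (<-≤-trans t<p p≤n)) u s
  ... | I = unbalanced-core (oneRightSpecial-complement h) (map not p)
    (λ t t<p v → no-unbalanced n h (map not t)
      (<-≤-trans (subst₂ _<_ (sym (length-map not t)) (length-map not p) t<p) p≤n)
      (unbalanced-complement t v))
    (unbalanced-map-not p u) (rightSpecial-map-not (I ∷ p) s)

  -- Two factors whose numbers of ones differ by at least 2 contain a pair 0p0, 1p1.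
  mutual
    balanced : ∀ {b} → OneRightSpecial b → ∀ u v → length u ≡ length v →
               Occurring b u → Occurring b v → ones u ≤ suc (ones v)
    balanced h []      []      e p q = z≤n
    balanced h (O ∷ u) (O ∷ v) e p q =
      balanced h u v (suc-injective e) (occurring-++ʳ (O ∷ []) p) (occurring-++ʳ (O ∷ []) q)
    balanced h (I ∷ u) (I ∷ v) e p q =
      s≤s (balanced h u v (suc-injective e) (occurring-++ʳ (I ∷ []) p) (occurring-++ʳ (I ∷ []) q))
    balanced h (O ∷ u) (I ∷ v) e p q = m≤n⇒m≤1+n
      (balanced h u v (suc-injective e) (occurring-++ʳ (O ∷ []) p) (occurring-++ʳ (I ∷ []) q))
    balanced h (I ∷ u) (O ∷ v) e p q = s≤s (scan h [] u v (suc-injective e) p q)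

    -- The block `z` is common to both words after the leading 1 and 0. A further 1 against 0
    -- completes 1z1 and 0z0, whereas a 0 against 1 cancels the excess.
    scan : ∀ {b} → OneRightSpecial b → ∀ z u v → length u ≡ length v →
           Occurring b (I ∷ z ++ u) → Occurring b (O ∷ z ++ v) → ones u ≤ ones v
    scan h z []      []      e p q = z≤n
    scan h z (O ∷ u) (O ∷ v) e p q =
      scan h (z ∷ʳ O) u v (suc-injective e) (occurring-∷ʳ-++ (I ∷ z) p) (occurring-∷ʳ-++ (O ∷ z) q)
    scan h z (I ∷ u) (I ∷ v) e p q =
      s≤s (scan h (z ∷ʳ I) u v (suc-injective e) (occurring-∷ʳ-++ (I ∷ z) p) (occurring-∷ʳ-++ (O ∷ z) q))
    scan h z (O ∷ u) (I ∷ v) e p q =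
      balanced h u v (suc-injective e) (occurring-++ʳ (I ∷ z ∷ʳ O) (occurring-∷ʳ-++ (I ∷ z) p))
                                       (occurring-++ʳ (O ∷ z ∷ʳ I) (occurring-∷ʳ-++ (O ∷ z) q))
    scan h z (I ∷ u) (O ∷ v) e p q = contradiction
      ( occurring-++ˡ (O ∷ z ∷ʳ O) (occurring-∷ʳ-++ (O ∷ z) q)
      , occurring-++ˡ (I ∷ z ∷ʳ I) (occurring-∷ʳ-++ (I ∷ z) p))
      (no-unbalanced (suc (length z)) h z ≤-refl)

-- Gaps of the lexicographic order

-- A consecutive pair that branches after l, of shape yet unknown; with x = 1u and y = 0u it becomes
-- `Central b l u`.
record Gap (b : InfiniteWord Bool) (l x y : Word Bool) : Set where
  field
    lower   : Occurring b (l ++ O ∷ x)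
    upper   : Occurring b (l ++ I ∷ y)
    maximal : ∀ z → length z ≡ length x → Occurring b (l ++ O ∷ z) → z ≼ x
    minimal : ∀ z → length z ≡ length y → Occurring b (l ++ I ∷ z) → y ≼ z

-- Every shorter competitor extends to a factor of full length, where it is compared; the comparison
-- passes to prefixes.
gap-prefix : ∀ {b l} x y {x′ y′} → Gap b l (x ++ x′) (y ++ y′) → Gap b l x y
gap-prefix {b} {l} x y {x′} {y′} g = record
  { lower   = occurring-++ˡ (l ++ O ∷ x) (assoc O x lower)
  ; upper   = occurring-++ˡ (l ++ I ∷ y) (assoc I y upper)
  ; maximal = λ z e p → let z′ , e′ , q = occurring-extend (l ++ O ∷ z) p (length x′) in
      ≼-++⁻ˡ z x e (maximal (z ++ z′) (lengths z x e e′) (assoc⁻ O z q))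
  ; minimal = λ z e p → let z′ , e′ , q = occurring-extend (l ++ I ∷ z) p (length y′) in
      ≼-++⁻ˡ y z (sym e) (minimal (z ++ z′) (lengths z y e e′) (assoc⁻ I z q))
  }
  where
  open Gap g
  assoc : ∀ a x {x′} → Occurring b (l ++ a ∷ x ++ x′) → Occurring b ((l ++ a ∷ x) ++ x′)
  assoc a x {x′} = subst (Occurring b) (sym (++-assoc l (a ∷ x) x′))
  assoc⁻ : ∀ a x {x′} → Occurring b ((l ++ a ∷ x) ++ x′) → Occurring b (l ++ a ∷ x ++ x′)
  assoc⁻ a x {x′} = subst (Occurring b) (++-assoc l (a ∷ x) x′)
  lengths : ∀ (z x : Word Bool) {z′ x′ : Word Bool} → length z ≡ length x → length z′ ≡ length x′ →
            length (z ++ z′) ≡ length (x ++ x′)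
  lengths z x e e′ = trans (length-++ z) (trans (cong₂ _+_ e e′) (sym (length-++ x)))

same-ones : ∀ x y → length x ≡ length y →
            (∀ x₁ x₂ y₁ y₂ → x ≡ x₁ ++ x₂ → y ≡ y₁ ++ y₂ → length x₁ ≡ length y₁ → ones x₁ ≡ ones y₁) →
            x ≡ y
same-ones []      []      _ _ = refl
same-ones (O ∷ x) (O ∷ y) e h = cong (O ∷_) (same-ones x y (suc-injective e)
  λ x₁ x₂ y₁ y₂ f g d → h (O ∷ x₁) x₂ (O ∷ y₁) y₂ (cong (O ∷_) f) (cong (O ∷_) g) (cong suc d))
same-ones (I ∷ x) (I ∷ y) e h = cong (I ∷_) (same-ones x y (suc-injective e)
  λ x₁ x₂ y₁ y₂ f g d → suc-injective
    (h (I ∷ x₁) x₂ (I ∷ y₁) y₂ (cong (I ∷_) f) (cong (I ∷_) g) (cong suc d)))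
same-ones (O ∷ x) (I ∷ y) e h with () ← h (O ∷ []) x (I ∷ []) y refl refl refl
same-ones (I ∷ x) (O ∷ y) e h with () ← h (I ∷ []) x (O ∷ []) y refl refl refl

module Extremal (em : ExcludedMiddle 0ℓ) where

  greatest : ∀ n (P : Word Bool → Set) → ∃[ x ] (length x ≡ n × P x) →
             ∃[ x ] (length x ≡ n × P x × ∀ y → length y ≡ n → P y → y ≼ x)
  greatest zero    P ([] , _ , p) = [] , refl , p , λ { [] _ _ → [] }
  greatest (suc n) P (z , e , p) with em {∃[ x ] (length x ≡ n × P (I ∷ x))}
  ... | yes h with x , f , q , max ← greatest n (P ∘ (I ∷_)) h =
    I ∷ x , cong suc f , q , λ where
      (I ∷ y) g r → I ∷ max y (suc-injective g) r
      (O ∷ y) g r → O≺I (trans (suc-injective g) (sym f))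
  ... | no ¬h with z
  ...   | I ∷ z′ = contradiction (z′ , suc-injective e , p) ¬h
  ...   | O ∷ z′ with x , f , q , max ← greatest n (P ∘ (O ∷_)) (z′ , suc-injective e , p) =
    O ∷ x , cong suc f , q , λ where
      (O ∷ y) g r → O ∷ max y (suc-injective g) r
      (I ∷ y) g r → contradiction (y , suc-injective g , r) ¬h

  least : ∀ n (P : Word Bool → Set) → ∃[ x ] (length x ≡ n × P x) →
          ∃[ x ] (length x ≡ n × P x × ∀ y → length y ≡ n → P y → x ≼ y)
  least n P (z , e , p)
    with x , f , q , max ← greatest n (P ∘ map not)
           (map not z , trans (length-map not z) e , subst P (sym (map-not-involutive z)) p) =
    map not x , trans (length-map not x) f , q , λ y g r →
      map-not-≼ y x (max (map not y) (trans (length-map not y) g) (subst P (sym (map-not-involutive y)) r))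

  branch : ∀ {b : InfiniteWord Bool} l {a n} → Occurring b (l ∷ʳ a) → ∃[ x ] (length x ≡ n × Occurring b (l ++ a ∷ x))
  branch {b} l {a} {n} o = let x , e , o′ = occurring-extend (l ∷ʳ a) o n in
    x , e , subst (Occurring b) (∷ʳ-++ l a x) o′

  gap-exists : ∀ {b} l → RightSpecial b l → ∀ n →
               ∃[ x ] ∃[ y ] (length x ≡ n × length y ≡ n × Gap b l x y)
  gap-exists {b} l (p , q) n
    with x , refl , p′ , max ← greatest n (λ x → Occurring b (l ++ O ∷ x)) (branch l p)
    with y , e , q′ , min ← least (length x) (λ y → Occurring b (l ++ I ∷ y)) (branch l q) =
    x , y , refl , e , record
      { lower = p′ ; upper = q′ ; maximal = max ; minimal = λ z f → min z (trans f e) }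
  module _ {b} (h : OneRightSpecial b) where

    open Balance em

    -- Where the words first differ, as 0u against 1v, balance allows u just the one extra 1 that
    -- begins 1v.
    balanced-mono : ∀ {u v} → u ≼ v → Occurring b u → Occurring b v → ones u ≤ ones v
    balanced-mono []                p q = z≤n
    balanced-mono (O ∷ r)           p q = balanced-mono r (occurring-++ʳ (O ∷ []) p) (occurring-++ʳ (O ∷ []) q)
    balanced-mono (I ∷ r)           p q = s≤s (balanced-mono r (occurring-++ʳ (I ∷ []) p) (occurring-++ʳ (I ∷ []) q))
    balanced-mono (O≺I {u} {v} e)   p q = balanced h u v e (occurring-++ʳ (O ∷ []) p) (occurring-++ʳ (I ∷ []) q)

    -- Otherwise the number of ones jumps between l0x and l1y; it also jumps
    -- between r0 and r1, where r is right special of length |l| + |x|, but that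
    -- jump lies on one side of the gap, and two jumps contradict balance.
    gap-ones : ∀ l x y → 0 < length x → length x ≡ length y → Gap b l x y → ones x ≡ suc (ones y)
    gap-ones l x@(_ ∷ x′) y _ e g = ≤-antisym
      (balanced h x y e (occurring-++ʳ (l ∷ʳ O) (occurring-∷ʳ-++ l lower))
                        (occurring-++ʳ (l ∷ʳ I) (occurring-∷ʳ-++ l upper)))
      (≮⇒≥ λ x<1+y → jump (≤-pred x<1+y))
      where
      open Gap g
      jump : ¬ ones x ≤ ones y
      jump x≤y with proj₁ h (length l + length x)
      ... | σ , lσ , p , q with split-at (length l) σ lσ
      ...   | l′ , c ∷ r , refl , ll , lr = side
        where
        reassoc : ∀ a → Occurring b ((l′ ++ c ∷ r) ++ a ∷ []) → Occurring b (l′ ++ c ∷ r ++ a ∷ [])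
        reassoc a = subst (Occurring b) (++-assoc l′ (c ∷ r) (a ∷ []))
        lr₁ : ∀ a → length (r ++ a ∷ []) ≡ length x
        lr₁ a = trans (length-∷ʳ r) lr
        σO σI : Word Bool
        σO = l′ ++ c ∷ r ++ O ∷ []
        σI = l′ ++ c ∷ r ++ I ∷ []
        oO : Occurring b σO
        oO = reassoc O p
        oI : Occurring b σI
        oI = reassoc I q
        jump-σ : ones σI ≡ suc (ones σO)
        jump-σ = trans (ones-++ l′ _) (trans (cong (ones l′ +_)
          (trans (ones-∷ʳI (c ∷ r)) (cong suc (sym (ones-∷ʳO (c ∷ r))))))
          (trans (+-suc _ _) (cong suc (sym (ones-++ l′ _)))))
        jump-gap : suc (ones (l ++ O ∷ x)) ≤ ones (l ++ I ∷ y)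
        jump-gap = subst₂ _≤_ (trans (+-suc _ _) (cong suc (sym (ones-++ l (O ∷ x))))) (sym (ones-++ l (I ∷ y)))
          (+-monoʳ-≤ (ones l) (s≤s x≤y))
        len-σ : ∀ a c′ v → length v ≡ length x → length (l′ ++ c ∷ r ++ a ∷ []) ≡ length (l ++ c′ ∷ v)
        len-σ a c′ v f = trans (length-++ l′)
          (trans (cong₂ _+_ ll (cong suc (trans (lr₁ a) (sym f)))) (sym (length-++ l)))
        below : ¬ σI ≼ l ++ O ∷ x
        below s = <-irrefl refl (begin
          suc (suc (ones σO))        ≡⟨ cong suc jump-σ ⟨
          suc (ones σI)              ≤⟨ s≤s (balanced-mono s oI lower) ⟩
          suc (ones (l ++ O ∷ x))    ≤⟨ jump-gap ⟩
          ones (l ++ I ∷ y)          ≤⟨ balanced h _ _ (sym (len-σ O I y (sym e))) upper oO ⟩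
          suc (ones σO)              ∎)
          where open ≤-Reasoning
        above : ¬ l ++ I ∷ y ≼ σO
        above s = <-irrefl refl (begin
          suc (ones σO)              ≡⟨ jump-σ ⟨
          ones σI                    ≤⟨ balanced h _ _ (len-σ I O x refl) oI lower ⟩
          suc (ones (l ++ O ∷ x))    ≤⟨ jump-gap ⟩
          ones (l ++ I ∷ y)          ≤⟨ balanced-mono s upper oO ⟩
          ones σO                    ∎)
          where open ≤-Reasoning
        -- When the right special word itself begins with l, its next letter selects a branch, and
        -- extremality of x or y puts both extensions on one side of the gap.
        at-gap : ∀ c → Occurring b (l ++ c ∷ r ++ O ∷ []) → Occurring b (l ++ c ∷ r ++ I ∷ []) →
                 (l ++ c ∷ r ++ I ∷ [] ≼ l ++ O ∷ x) ⊎ (l ++ I ∷ y ≼ l ++ c ∷ r ++ O ∷ [])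
        at-gap O _ q = inj₁ (≼-++ (≼-refl l) (cong suc (lr₁ I)) λ _ → O ∷ maximal (r ++ I ∷ []) (lr₁ I) q)
        at-gap I p _ = inj₂ (≼-++ (≼-refl l) (sym (cong suc (trans (lr₁ O) e)))
          λ _ → I ∷ minimal (r ++ O ∷ []) (trans (lr₁ O) e) p)
        side : ⊥
        side with em {l′ ≡ l} | ≼-total l′ l ll
        ... | no ≢l  | inj₁ s = below (≼-++ s (cong suc (lr₁ I)) λ f → contradiction f ≢l)
        ... | no ≢l  | inj₂ s = above (≼-++ s (sym (cong suc (trans (lr₁ O) e))) λ f → contradiction (sym f) ≢l)
        ... | yes f | _ with at-gap c (subst (λ l → Occurring b (l ++ c ∷ r ++ O ∷ [])) f oO)
                                      (subst (λ l → Occurring b (l ++ c ∷ r ++ I ∷ [])) f oI)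
        ...   | inj₁ s = below (subst (λ k → k ++ c ∷ r ++ I ∷ [] ≼ l ++ O ∷ x) (sym f) s)
        ...   | inj₂ s = above (subst (λ k → l ++ I ∷ y ≼ k ++ c ∷ r ++ O ∷ []) (sym f) s)

    -- Equally long prefixes of the two sides form a gap again, so `gap-ones` equates all prefix
    -- counts.
    gap-swap : ∀ l x y → length x ≡ length y → Gap b l (I ∷ x) (O ∷ y) → x ≡ y
    gap-swap l x y e g = same-ones x y e λ where
      x₁ x₂ y₁ y₂ refl refl f → suc-injective
        (gap-ones l (I ∷ x₁) (O ∷ y₁) (s≤s z≤n) (cong suc f) (gap-prefix (I ∷ x₁) (O ∷ y₁) g))

    gap-first : ∀ l {a c} x y → Gap b l (a ∷ x) (c ∷ y) → a ≡ I × c ≡ O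
    gap-first l {a} {c} x y g
      with a | c | gap-ones l (a ∷ []) (c ∷ []) (s≤s z≤n) refl (gap-prefix (a ∷ []) (c ∷ []) g)
    ... | I | O | _ = refl , refl

    oneRightSpecial-hasCentral : HasCentral b
    oneRightSpecial-hasCentral l r m with gap-exists l r (suc m)
    ... | a ∷ x , c ∷ y , lx , ly , g with refl , refl ← gap-first l x y g
      with refl ← gap-swap l x y (suc-injective (trans lx (sym ly))) g =
      x , suc-injective lx , record { Gap g }

-- Coding over a totally ordered alphabet

between : ∀ l {x y f} → l ++ O ∷ x ≼ f → f ≼ l ++ I ∷ y →
          ∃[ z ] (f ≡ l ++ O ∷ z × x ≼ z ⊎ f ≡ l ++ I ∷ z × z ≼ y)
between []      {f = O ∷ z} (O ∷ p) q       = z , inj₁ (refl , p)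
between []      {f = I ∷ z} p       (I ∷ q) = z , inj₂ (refl , q)
between (O ∷ l) (O ∷ p) (O ∷ q) with between l p q
... | z , inj₁ (refl , h) = z , inj₁ (refl , h)
... | z , inj₂ (refl , h) = z , inj₂ (refl , h)
between (I ∷ l) (I ∷ p) (I ∷ q) with between l p q
... | z , inj₁ (refl , h) = z , inj₁ (refl , h)
... | z , inj₂ (refl , h) = z , inj₂ (refl , h)
between (O ∷ l) (O≺I e) ()

at-cong : ∀ {A : Set} {w w′ : InfiniteWord A} → (∀ i → w i ≡ w′ i) → ∀ {i} u → At w i u → At w′ i u
at-cong h []      _       = tt
at-cong h (a ∷ u) (e , p) = trans (sym (h _)) e , at-cong h u p

map-image : ∀ {A B : Set} {f : A → B} vs → (∀ {v} → v ∈ vs → ∃[ u ] v ≡ f u) → ∃[ us ] vs ≡ map f us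
map-image []       h = [] , refl
map-image (v ∷ vs) h with u , refl ← h (here refl) | us , refl ← map-image vs (h ∘ there) = u ∷ us , refl

module Coding (em : ExcludedMiddle 0ℓ) {A : Set} {_<_ : Rel A 0ℓ} (sto : IsStrictTotalOrder _≡_ _<_)
              {𝟎 𝟏 : A} (𝟎<𝟏 : 𝟎 < 𝟏) where

  open IsStrictTotalOrder sto using (compare; irrefl; asym)
    renaming (trans to <-tr)

  letter : Bool → A
  letter O = 𝟎
  letter I = 𝟏

  𝟎≢𝟏 : 𝟎 ≢ 𝟏
  𝟎≢𝟏 e = irrefl e 𝟎<𝟏

  letter-injective : ∀ {x y} → letter x ≡ letter y → x ≡ y
  letter-injective {O} {O} _ = refl
  letter-injective {I} {I} _ = refl
  letter-injective {O} {I} e = contradiction e 𝟎≢𝟏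
  letter-injective {I} {O} e = contradiction (sym e) 𝟎≢𝟏

  letter-< : ∀ {x y} → letter x < letter y → x ≡ O × y ≡ I
  letter-< {O} {O} p = contradiction p (irrefl refl)
  letter-< {O} {I} p = refl , refl
  letter-< {I} {O} p = contradiction p (asym 𝟎<𝟏)
  letter-< {I} {I} p = contradiction p (irrefl refl)

  encode : Word Bool → Word A
  encode = map letter

  encode-injective : ∀ {u v} → encode u ≡ encode v → u ≡ v
  encode-injective = map-injective letter-injective

  ≼⇒lex : ∀ {u v} → u ≼ v → u ≢ v → Lex _<_ (encode u) (encode v)
  ≼⇒lex []      ne = contradiction refl ne
  ≼⇒lex (a ∷ p) ne with e , l , c , d , c<d , p₁ , p₂ ← ≼⇒lex p (ne ∘ cong (a ∷_)) =
    cong suc e , letter a ∷ l , c , d , c<d , refl ∷ p₁ , refl ∷ p₂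
  ≼⇒lex {O ∷ u} {I ∷ v} (O≺I e) ne =
    cong suc (trans (length-map letter u) (trans e (sym (length-map letter v)))) ,
    [] , 𝟎 , 𝟏 , 𝟎<𝟏 , refl ∷ [] , refl ∷ []

  Branch : Word Bool → Word Bool → Set
  Branch u v = ∃[ l ] ∃[ x ] ∃[ y ] (u ≡ l ++ O ∷ x × v ≡ l ++ I ∷ y × length x ≡ length y)

  lex⇒branch : ∀ {u v} → Lex _<_ (encode u) (encode v) → Branch u v
  lex⇒branch {u} {v} (e , l , c , d , c<d , p , q) =
    go l u v (trans (sym (length-map letter u)) (trans e (length-map letter v))) p q
    where
    go : ∀ l u v → length u ≡ length v → Prefix _≡_ (l ∷ʳ c) (encode u) → Prefix _≡_ (l ∷ʳ d) (encode v) → Branch u v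
    go []      (a ∷ u) (b ∷ v) e (refl ∷ _) (refl ∷ _) with refl , refl ← letter-< c<d =
      [] , u , v , refl , refl , suc-injective e
    go (_ ∷ l) (a ∷ u) (b ∷ v) e (refl ∷ p) (f ∷ q) with refl ← letter-injective f
      with k , x , y , refl , refl , h ← go l u v (suc-injective e) p q =
      a ∷ k , x , y , refl , refl , h

  branch-≼ : ∀ {u v} → Branch u v → u ≼ v × u ≢ v
  branch-≼ (l , x , y , refl , refl , e) =
    ≼-++ (≼-refl l) (cong suc e) (λ _ → O≺I e) , λ f → case-≡ (++-cancelˡ l _ _ f)
    where
    case-≡ : O ∷ x ≢ I ∷ y
    case-≡ ()

  -- The place where two words first differ is determined by them, so the two factorisations
  -- coincide.
  swap-cases : ∀ l l′ {x y α β s t} → α ≢ β →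
               encode (l ++ O ∷ x) ≡ l′ ++ α ∷ s → encode (l ++ I ∷ y) ≡ l′ ++ β ∷ t →
               α ≡ 𝟎 × encode x ≡ s × encode y ≡ t
  swap-cases []      []       ne refl refl = refl , refl , refl
  swap-cases []      (_ ∷ l′) ne e    f    =
    contradiction (trans (∷-injectiveˡ e) (sym (∷-injectiveˡ f))) 𝟎≢𝟏
  swap-cases (_ ∷ l) []       ne e    f    =
    contradiction (trans (sym (∷-injectiveˡ e)) (∷-injectiveˡ f)) ne
  swap-cases (_ ∷ l) (_ ∷ l′) ne e    f    = swap-cases l l′ ne (∷-injectiveʳ e) (∷-injectiveʳ f)

  -- A nonempty x rules out the pair λ0, λ1; the branching letters fix the orientation of the swap.
  swapOrLastLetter⇒swap : ∀ l x y → 0 ℕ.< length x →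
    SwapOrLastLetter 𝟎 𝟏 (encode (l ++ O ∷ x)) (encode (l ++ I ∷ y)) →
    ∃[ u ] (x ≡ I ∷ u × y ≡ O ∷ u)
  swapOrLastLetter⇒swap l x y 0<x (l′ , m , h) = go h
    where
    distinct : encode (l ++ O ∷ x) ≢ encode (l ++ I ∷ y)
    distinct e with () ← ++-cancelˡ l _ _ (encode-injective e)
    decode : ∀ x y → encode x ≡ 𝟏 ∷ m → encode y ≡ 𝟎 ∷ m → ∃[ u ] (x ≡ I ∷ u × y ≡ O ∷ u)
    decode (a ∷ x) (c ∷ y) e f
      with refl ← letter-injective {a} {I} (∷-injectiveˡ e)
         | refl ← letter-injective {c} {O} (∷-injectiveˡ f)
         | refl ← encode-injective (trans (∷-injectiveʳ e) (sym (∷-injectiveʳ f))) = x , refl , refl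
    nonempty : ∀ x → 0 ℕ.< length x → encode x ≢ []
    nonempty (_ ∷ _) _ ()
    go : (BothIn _ _ _ ⊎ BothIn _ _ _) → ∃[ u ] (x ≡ I ∷ u × y ≡ O ∷ u)
    go (inj₁ (here e , there (here f))) =
      let _ , e′ , f′ = swap-cases l l′ 𝟎≢𝟏 e f in decode x y e′ f′
    go (inj₁ (there (here e) , here f)) =
      contradiction (sym (proj₁ (swap-cases l l′ (𝟎≢𝟏 ∘ sym) e f))) 𝟎≢𝟏
    go (inj₁ (here e , here f))                 = contradiction (trans e (sym f)) distinct
    go (inj₁ (there (here e) , there (here f))) = contradiction (trans e (sym f)) distinct
    go (inj₂ (here e , there (here f))) =
      contradiction (proj₁ (proj₂ (swap-cases l l′ 𝟎≢𝟏 e f))) (nonempty x 0<x)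
    go (inj₂ (there (here e) , here f)) =
      contradiction (sym (proj₁ (swap-cases l l′ (𝟎≢𝟏 ∘ sym) e f))) 𝟎≢𝟏
    go (inj₂ (here e , here f))                 = contradiction (trans e (sym f)) distinct
    go (inj₂ (there (here e) , there (here f))) = contradiction (trans e (sym f)) distinct

  module _ {w : InfiniteWord A} {b : InfiniteWord Bool} (coded : ∀ i → w i ≡ letter (b i)) where

    factor-encode : ∀ u → Occurring b u → Factor w (encode u)
    factor-encode u (i , p) = occurring⇒factor (encode u)
      (i , at-cong (sym ∘ coded) (encode u) (at-map⁺ u p))

    encode-factor : ∀ u → Factor w (encode u) → Occurring b u
    encode-factor u f with i , p ← factor⇒occurring (encode u) f =
      i , at-map⁻ letter-injective u (at-cong coded (encode u) p)

    factor-image : ∀ v → Factor w v → ∃[ u ] v ≡ encode u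
    factor-image v f with i , p ← factor⇒occurring v f = at-map-image v (at-cong coded v p)

    sturmian-encode : Sturmian b → Sturmian w
    sturmian-encode st n with us , len , unique , members ← st n =
      map encode us , trans (length-map encode us) len , Unique.map⁺ encode-injective unique ,
      λ v → mk⇔ sound complete
      where
      sound : ∀ {v} → v ∈ map encode us → Factor w v × length v ≡ n
      sound v∈ with u , u∈ , refl ← ∈-map⁻ encode v∈ with f , e ← Equivalence.to (members u) u∈ =
        factor-encode u (factor⇒occurring u f) , trans (length-map letter u) e
      complete : ∀ {v} → Factor w v × length v ≡ n → v ∈ map encode us
      complete {v} (f , e) with u , refl ← factor-image v f =
        ∈-map⁺ encode (Equivalence.from (members u)
          (occurring⇒factor u (encode-factor u f) , trans (sym (length-map letter u)) e))

    sturmian-decode : Sturmian w → Sturmian b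
    sturmian-decode st n with vs , len , unique , members ← st n
      with us , refl ← map-image vs (λ {v} v∈ → factor-image v (proj₁ (Equivalence.to (members v) v∈))) =
      us , trans (sym (length-map encode us)) len , Unique.map⁻ unique , λ u → mk⇔ (sound u) (complete u)
      where
      sound : ∀ u → u ∈ us → Factor b u × length u ≡ n
      sound u u∈ with f , e ← Equivalence.to (members (encode u)) (∈-map⁺ encode u∈) =
        occurring⇒factor u (encode-factor u f) , trans (sym (length-map letter u)) e
      complete : ∀ u → Factor b u × length u ≡ n → u ∈ us
      complete u (f , e) with u′ , u′∈ , h ← ∈-map⁻ encode (Equivalence.from (members (encode u))
        (factor-encode u (factor⇒occurring u f) , trans (length-map letter u) e))
        with refl ← encode-injective h = u′∈

    -- A factor in between has prefix l0 or l1 by `between`, and extremality identifies it with an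
    -- end of the gap.
    gap-consecutive : ∀ l x y → length x ≡ length y → Gap b l x y →
                      Consecutive _<_ w (encode (l ++ O ∷ x)) (encode (l ++ I ∷ y))
    gap-consecutive l x y e g = factor-encode _ lower , factor-encode _ upper ,
      (let p , ne = branch-≼ (l , x , y , refl , refl , e) in ≼⇒lex p ne) , none
      where
      open Gap g
      none : ¬ (∃[ f ] (Factor w f × Lex _<_ (encode (l ++ O ∷ x)) f × Lex _<_ f (encode (l ++ I ∷ y))))
      none (f , ff , p , q) with f′ , refl ← factor-image f ff
        with p′ , ne ← branch-≼ (lex⇒branch p) | q′ , ne′ ← branch-≼ (lex⇒branch q)
        with between l p′ q′
      ... | z , inj₁ (refl , h) = ne (cong (λ z → l ++ O ∷ z)
        (≼-antisym h (maximal z (sym (≼-length h)) (encode-factor _ ff))))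
      ... | z , inj₂ (refl , h) = ne′ (cong (λ z → l ++ I ∷ z)
        (≼-antisym h (minimal z (≼-length h) (encode-factor _ ff))))

    swap⇒hasCentral : (∀ v v′ → Consecutive _<_ w v v′ → SwapOrLastLetter 𝟎 𝟏 v v′) → HasCentral b
    swap⇒hasCentral cond l r m
      with x , y , lx , ly , g ← Extremal.gap-exists em l r (suc m)
      with u , refl , refl ← swapOrLastLetter⇒swap l x y (subst (0 ℕ.<_) (sym lx) (s≤s z≤n))
        (cond _ _ (gap-consecutive l x y (trans lx (sym ly)) g)) =
      u , suc-injective lx , record { Gap g }

    -- For nonempty x both l01t and l10t lie weakly between the two factors; consecutiveness makes
    -- them equal to these.
    hasCentral⇒swap : HasCentral b → ∀ v v′ → Consecutive _<_ w v v′ → SwapOrLastLetter 𝟎 𝟏 v v′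
    hasCentral⇒swap K v v′ (f , f′ , lex , none)
      with u , refl ← factor-image v f | u′ , refl ← factor-image v′ f′
      with lex⇒branch lex
    ... | l , [] , [] , refl , refl , e =
      encode l , [] , inj₂ (here (map-++ letter l _) , there (here (map-++ letter l _)))
    ... | l , x@(_ ∷ x₁) , y , refl , refl , e
      with t , lt , c ← K l (rightSpecial-branch l (encode-factor _ f) (encode-factor _ f′)) (length x₁)
      with em {x ≡ I ∷ t} | em {y ≡ O ∷ t}
    ...   | yes refl | yes refl =
      encode l , encode t , inj₁ (here (map-++ letter l _) , there (here (map-++ letter l _)))
    ...   | no ne | _ = contradiction
      ( encode (l ++ O ∷ I ∷ t) , factor-encode _ lower
      , ≼⇒lex (≼-++ (≼-refl l) (cong suc ex) λ _ → O ∷ maximal x ex (encode-factor _ f))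
              (ne ∘ ∷-injectiveʳ ∘ ++-cancelˡ l _ _)
      , (let p , ne′ = branch-≼ (l , _ , y , refl , refl , trans (sym ex) e) in ≼⇒lex p ne′)) none
      where
      open Central c
      ex : length x ≡ suc (length t)
      ex = cong suc (sym lt)
    ...   | yes _ | no ne = contradiction
      ( encode (l ++ I ∷ O ∷ t) , factor-encode _ upper
      , (let p , ne′ = branch-≼ (l , x , _ , refl , refl , cong suc (sym lt)) in ≼⇒lex p ne′)
      , ≼⇒lex (≼-++ (≼-refl l) (cong suc (sym ey)) λ _ → I ∷ minimal y ey (encode-factor _ f′))
              (ne ∘ sym ∘ ∷-injectiveʳ ∘ ++-cancelˡ l _ _)) none
      where
      open Central c
      ey : length y ≡ suc (length t)
      ey = trans (sym e) (cong suc (sym lt))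

  -- Reduction to two letters

  binary-code : (w : InfiniteWord A) → (∀ c → Occurs c w → c ≡ 𝟎 ⊎ c ≡ 𝟏) →
                ∃[ b ] ∀ i → w i ≡ letter (b i)
  binary-code w h = (λ i → proj₁ (code i)) , (λ i → proj₂ (code i))
    where
    code : ∀ i → ∃[ a ] w i ≡ letter a
    code i with h (w i) (i , refl)
    ... | inj₁ e = O , e
    ... | inj₂ e = I , e

  singleton-factor : ∀ {w : InfiniteWord A} {c} → Occurs c w → Factor w (c ∷ [])
  singleton-factor {w} (i , e) = occurring⇒factor {w = w} (_ ∷ []) (i , e , tt)

  sturmian-binary : ∀ {w} → Occurs 𝟎 w → Occurs 𝟏 w → Sturmian w → ∀ c → Occurs c w → c ≡ 𝟎 ⊎ c ≡ 𝟏
  sturmian-binary {w} o₀ o₁ st c o with em {c ≡ 𝟎} | em {c ≡ 𝟏}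
  ... | yes e | _     = inj₁ e
  ... | _     | yes e = inj₂ e
  ... | no c≢𝟎 | no c≢𝟏 with vs , len , _ , members ← st 1 =
    contradiction (subst (3 ≤_) len (unique-length {us = (c ∷ []) ∷ (𝟎 ∷ []) ∷ (𝟏 ∷ []) ∷ []}
      ((c≢𝟎 ∘ ∷-injectiveˡ ∷ c≢𝟏 ∘ ∷-injectiveˡ ∷ []) ∷ (𝟎≢𝟏 ∘ ∷-injectiveˡ ∷ []) ∷ [] ∷ []) sub))
      λ { (s≤s (s≤s ())) }
    where
    sub : ∀ {v} → v ∈ (c ∷ []) ∷ (𝟎 ∷ []) ∷ (𝟏 ∷ []) ∷ [] → v ∈ vs
    sub (here refl)                 = Equivalence.from (members _) (singleton-factor o , refl)
    sub (there (here refl))         = Equivalence.from (members _) (singleton-factor o₀ , refl)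
    sub (there (there (here refl))) = Equivalence.from (members _) (singleton-factor o₁ , refl)

  least-letter : (P : A → Set) → ∀ cs → ∃[ c ] (c ∈ cs × P c) →
                 ∃[ c ] (P c × ∀ {d} → d ∈ cs → P d → ¬ d < c)
  least-letter P (a ∷ cs) (c , c∈ , pc) with em {∃[ d ] (d ∈ cs × P d)}
  ... | no none with c∈
  ...   | there c∈′ = contradiction (c , c∈′ , pc) none
  ...   | here refl = c , pc , λ where
    (here refl)  _  → irrefl refl
    (there d∈) pd → contradiction (_ , d∈ , pd) none
  least-letter P (a ∷ cs) (c , c∈ , pc) | yes some
    with m , pm , min ← least-letter P cs some with em {P a × a < m}
  ... | yes (pa , a<m) = a , pa , λ where
    (here refl) _ → irrefl refl
    (there d∈) pd d<a → min d∈ pd (<-tr d<a a<m)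
  ... | no ¬a<m = m , pm , λ where
    (here refl) pa a<m → ¬a<m (pa , a<m)
    (there d∈) pd → min d∈ pd

  lex-singleton : ∀ {c d} → Lex _<_ (c ∷ []) (d ∷ []) → c < d
  lex-singleton (_ , []         , _ , _ , c<d , refl ∷ _ , refl ∷ _) = c<d
  lex-singleton (_ , _ ∷ []     , _ , _ , c<d , _ ∷ ()   , _)
  lex-singleton (_ , _ ∷ _ ∷ _ , _ , _ , c<d , _ ∷ ()   , _)

  swap-singleton : ∀ {c d} → SwapOrLastLetter 𝟎 𝟏 (c ∷ []) (d ∷ []) → (c ≡ 𝟎 ⊎ c ≡ 𝟏) × (d ≡ 𝟎 ⊎ d ≡ 𝟏)
  swap-singleton (l , m , inj₁ (p , q)) = ⊥-elim (long l p)
    where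
    long : ∀ {c} l → c ∷ [] ∈ (l ++ 𝟎 ∷ 𝟏 ∷ m) ∷ (l ++ 𝟏 ∷ 𝟎 ∷ m) ∷ [] → ⊥
    long []          (here ())
    long []          (there (here ()))
    long (_ ∷ [])    (here ())
    long (_ ∷ [])    (there (here ()))
    long (_ ∷ _ ∷ _) (here ())
    long (_ ∷ _ ∷ _) (there (here ()))
  swap-singleton (l , m , inj₂ (p , q)) = last l p , last l q
    where
    last : ∀ {c} l → c ∷ [] ∈ (l ∷ʳ 𝟎) ∷ (l ∷ʳ 𝟏) ∷ [] → c ≡ 𝟎 ⊎ c ≡ 𝟏
    last []          (here refl)         = inj₁ refl
    last []          (there (here refl)) = inj₂ refl
    last (_ ∷ [])    (here ())
    last (_ ∷ [])    (there (here ()))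
    last (_ ∷ _ ∷ _) (here ())
    last (_ ∷ _ ∷ _) (there (here ()))

  -- Finiteness gives each letter of `w` below another one a successor in `w`, and the condition on
  -- this pair of one-letter words confines both to 0 and 1. It applies to c itself if c < 1; if c >
  -- 1, it would make the successor of 1 equal to 0 or 1.
  swap-binary : ∀ {k} → A ↔ Fin k → ∀ {w} → Occurs 𝟎 w → Occurs 𝟏 w →
    (∀ v v′ → Consecutive _<_ w v v′ → SwapOrLastLetter 𝟎 𝟏 v v′) →
    ∀ c → Occurs c w → c ≡ 𝟎 ⊎ c ≡ 𝟏
  swap-binary {k} A↔Fin {w} o₀ o₁ cond = letters
    where
    all-letters : List A
    all-letters = map (Inverse.from A↔Fin) (allFin k)
    ∈-all-letters : ∀ c → c ∈ all-letters
    ∈-all-letters c = subst (_∈ all-letters) (Inverse.strictlyInverseʳ A↔Fin c)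
      (∈-map⁺ (Inverse.from A↔Fin) (∈-allFin (Inverse.to A↔Fin c)))
    successor : ∀ c → Occurs c w → ∃[ d ] (Occurs d w × c < d) →
                ∃[ d ] (c < d × (c ≡ 𝟎 ⊎ c ≡ 𝟏) × (d ≡ 𝟎 ⊎ d ≡ 𝟏))
    successor c o (d , od , c<d)
      with m , (om , c<m) , min ← least-letter (λ d → Occurs d w × c < d) all-letters (d , ∈-all-letters d , od , c<d) =
      m , c<m , swap-singleton (cond (c ∷ []) (m ∷ [])
        (singleton-factor o , singleton-factor om , (refl , [] , c , m , c<m , refl ∷ [] , refl ∷ []) , none))
      where
      none : ¬ (∃[ f ] (Factor w f × Lex _<_ (c ∷ []) f × Lex _<_ f (m ∷ [])))
      none (e ∷ [] , f , p , q) with i , g , _ ← factor⇒occurring (e ∷ []) f =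
        min (∈-all-letters e) ((i , g) , lex-singleton p) (lex-singleton q)
      none ([] , _ , (() , _) , _)
      none (_ ∷ _ ∷ _ , _ , (() , _) , _)
    letters : ∀ c → Occurs c w → c ≡ 𝟎 ⊎ c ≡ 𝟏
    letters c o with compare c 𝟏
    ... | tri< c<𝟏 _ _ = let _ , _ , p , _ = successor c o (𝟏 , o₁ , c<𝟏) in p
    ... | tri≈ _ c≡𝟏 _ = inj₂ c≡𝟏
    ... | tri> _ _ 𝟏<c with successor 𝟏 o₁ (c , o , 𝟏<c)
    ...   | d , 𝟏<d , _ , inj₁ refl = contradiction 𝟏<d (asym 𝟎<𝟏)
    ...   | d , 𝟏<d , _ , inj₂ refl = contradiction 𝟏<d (irrefl refl)

theorem1p1 : ExcludedMiddle 0ℓ →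
    (A : Set) (k : ℕ) → A ↔ Fin k →
    (_<_ : Rel A 0ℓ) → IsStrictTotalOrder _≡_ _<_ →
    (𝟎 𝟏 : A) → 𝟎 < 𝟏 →
    (w : InfiniteWord A) → Occurs 𝟎 w → Occurs 𝟏 w →
    Sturmian w ⇔
    (∀ v v′ → Consecutive _<_ w v v′ → SwapOrLastLetter 𝟎 𝟏 v v′)
theorem1p1 em A k A↔Fin _<_ sto 𝟎 𝟏 𝟎<𝟏 w o₀ o₁ = mk⇔ to from
  where
  open Coding em sto 𝟎<𝟏
  to : Sturmian w → ∀ v v′ → Consecutive _<_ w v v′ → SwapOrLastLetter 𝟎 𝟏 v v′
  to st with b , coded ← binary-code w (sturmian-binary o₀ o₁ st)
    with st′ ← sturmian-decode coded st =
    hasCentral⇒swap coded (Extremal.oneRightSpecial-hasCentral em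
      (Counting.sturmian-exists em b st′ , Counting.sturmian-unique em b st′))
  from : (∀ v v′ → Consecutive _<_ w v v′ → SwapOrLastLetter 𝟎 𝟏 v v′) → Sturmian w
  from cond with b , coded ← binary-code w (swap-binary A↔Fin o₀ o₁ cond)
    with K ← swap⇒hasCentral coded cond =
    sturmian-encode coded (Counting.sturmian-rightSpecial em b
      (rightSpecial-exists K (single O o₀ , single I o₁)) (rightSpecial-unique K))
    where
    single : ∀ a → Occurs (letter a) w → Occurring b (a ∷ [])
    single a o = encode-factor coded (a ∷ []) (singleton-factor o)
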